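{- The function $F$ satisfies: $F(0)=0$, $F(1)=2$, $F(2)=4$, $5\le F(3)\le 74$, $16\le F(4)\le 13439$, and $256\le F(5)\le 1.08\cdot 10^{189}$.
   Context: All games are short normal-play two-player combinatorial games (Left and Right; a player unable to move loses), compared up to equality ($Y=Z$ iff $X+Y$ and $X+Z$ have the same outcome for every game $X$, $+$ being the disjunctive sum). The birthday of a game is the maximum length of a sequence of moves (not necessarily alternating) starting from it; a value is born by day $b$ if it equals some game of birthday at most $b$; $\mathbb{G}_b$ is the set of values born by day $b$. A Digraph placement game is played on a finite digraph with vertices coloured blue/red (not necessarily properly): Left chooses a remaining blue vertex and deletes it with all its out-neighbours, Right does the same with a red vertex; a player unable to move loses. For a game $X$, $f(X)$ is the least $n$ such that some Digraph placement game on $n$ vertices equals $X$, and $F(b)=\max_{X\in\mathbb{G}_b}f(X)$. -}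

module Defs where

open import Data.Nat using (ℕ; zero; suc; _+_; _*_; _^_; _≤_; _<_; _⊔_)
open import Data.Bool using (Bool; true; false; _∧_; _∨_; not)
open import Data.Fin using (Fin; splitAt; _≟_)
open import Data.List using (List; []; _∷_; length; allFin)
open import Data.List using (lookup)
open import Data.Sum using (inj₁; inj₂; [_,_]′)
open import Data.Product using (Σ; _×_; _,_; ∃)
open import Relation.Nullary using (¬_; does)
open import Relation.Binary.PropositionalEquality using (_≡_)

-- Short combinatorial games (game trees, not values).
-- A game has finitely many Left options (indexed by Fin m)
-- and finitely many Right options (indexed by Fin n).

data Game : Set where
  mk : (m : ℕ) → (Fin m → Game) → (n : ℕ) → (Fin n → Game) → Game

infixl 6 _⊕_
_⊕_ : Game → Game → Game
mk m L n R ⊕ mk m' L' n' R' =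
  mk (m + m')
     (λ i → [ (λ a → L a ⊕ mk m' L' n' R') , (λ b → mk m L n R ⊕ L' b) ]′ (splitAt m i))
     (n + n')
     (λ j → [ (λ a → R a ⊕ mk m' L' n' R') , (λ b → mk m L n R ⊕ R' b) ]′ (splitAt n j))

anyFin : (m : ℕ) → (Fin m → Bool) → Bool
anyFin zero    f = false
anyFin (suc m) f = f Fin.zero ∨ anyFin m (λ i → f (Fin.suc i))

maxFin : (m : ℕ) → (Fin m → ℕ) → ℕ
maxFin zero    f = 0
maxFin (suc m) f = f Fin.zero ⊔ maxFin m (λ i → f (Fin.suc i))

-- Normal play: a player unable to move loses.
-- leftWinsFirst G  : Left, moving first in G, has a winning strategy.
-- rightWinsFirst G : Right, moving first in G, has a winning strategy.
leftWinsFirst  : Game → Bool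
rightWinsFirst : Game → Bool
leftWinsFirst  (mk m L n R) = anyFin m (λ i → not (rightWinsFirst (L i)))
rightWinsFirst (mk m L n R) = anyFin n (λ j → not (leftWinsFirst (R j)))

outcome : Game → Bool × Bool
outcome G = leftWinsFirst G , rightWinsFirst G

infix 4 _≈_
_≈_ : Game → Game → Set
Y ≈ Z = ∀ (X : Game) → outcome (X ⊕ Y) ≡ outcome (X ⊕ Z)

birthday : Game → ℕ
birthday (mk m L n R) =
  bd m n (maxFin m (λ i → birthday (L i)) ⊔ maxFin n (λ j → birthday (R j)))
  where
  bd : ℕ → ℕ → ℕ → ℕ
  bd zero zero _ = 0
  bd _    _    k = suc k

BornBy : ℕ → Game → Set
BornBy b X = Σ Game (λ G → birthday G ≤ b × G ≈ X)

record Digraph : Set where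
  field
    size : ℕ
    blue : Fin size → Bool               -- true = blue, false = red
    arc  : Fin size → Fin size → Bool    -- arc u v : there is an arc u → v
open Digraph public

fromLists : List Game → List Game → Game
fromLists ls rs = mk (length ls) (lookup ls) (length rs) (lookup rs)

delete : (D : Digraph) → Fin (size D) → (Fin (size D) → Bool) → (Fin (size D) → Bool)
delete D v S w = S w ∧ not (does (w ≟ v) ∨ arc D v w)

-- Game played on the remaining set S, with a fuel k (k ≥ |S| suffices,
-- since every move deletes at least one remaining vertex).
placeGame : (D : Digraph) → ℕ → (Fin (size D) → Bool) → Game
placeGame D zero    S = mk 0 (λ ()) 0 (λ ())
placeGame D (suc k) S = fromLists (opts true (allFin (size D))) (opts false (allFin (size D)))
  where
  opts : Bool → List (Fin (size D)) → List Game
  opts c [] = []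
  opts c (v ∷ vs) with S v ∧ (does (Data.Bool._≟_ (blue D v) c))
  ... | true  = placeGame D k (delete D v S) ∷ opts c vs
  ... | false = opts c vs

digraphGame : Digraph → Game
digraphGame D = placeGame D (size D) (λ _ → true)

RealisableOn : ℕ → Game → Set
RealisableOn n X = Σ Digraph (λ D → size D ≡ n × digraphGame D ≈ X)

-- f(X) = least n with RealisableOn n X;  F(b) = max_{X ∈ 𝔾_b} f(X).
-- Bounds on F are stated by unfolding the max and the least:

FLe : ℕ → ℕ → Set
FLe b N = ∀ X → BornBy b X → Σ ℕ (λ n → n ≤ N × RealisableOn n X)

FGe : ℕ → ℕ → Set
FGe b M = Σ Game (λ X → BornBy b X × (∀ n → n < M → ¬ RealisableOn n X))

FEq : ℕ → ℕ → Set
FEq b N = FLe b N × FGe b N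

-- Lower bounds. Extra red vertices never help Left and extra blue vertices
-- never help Right, so a position with p blue and q red vertices lies between
-- -q and p; the games {n | -n} give F(1), F(2) and F(3). For F(4), let
-- X = {A | -3} with A an antichain of hot games born by day 3, and let Z ≤ X be
-- a position in which Left can move to a game ≥ a, for each a in a subset I of A.
-- If one vertex serves two elements of I, the position after it is reversible
-- through a position Y ≤ X that still serves both and has at least two blue and
-- two red vertices fewer than Z, because by monotonicity the first move deletes
-- a red vertex and the reply a blue one. All these positions have at least four
-- vertices of each colour, so on 15 vertices the reversal cannot be iterated,
-- and a digraph realising X has |A| ≤ 63. The middle rank of the lattice of
-- games born by day 3 contains 65 suitable games. For F(5) there are more hot
-- games {S | -4} than digraphs with fewer than 256 vertices, S running over the
-- subsets of an antichain of 2^17 games born by day 4.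
--
-- Upper bounds. If the games born by day b are covered by w chains, then a game
-- born by day b + 1 needs at most w options for each player. Giving every option
-- a private copy of its digraph, a vertex that deletes everything else, and a
-- common gadget that makes all other moves reversible, one gets
-- F(b + 1) ≤ 2 w (1 + F(b)) + 4 (b + 2). A greedy search finds the chains for
-- b ≤ 3; a game born by day 4 is determined by its heights in the chains of day
-- 3, which bounds the number of these games by 4 · 10^184.

module Submission where

open import Defs
open import Data.Bool using (Bool; true; false; _∧_; _∨_; not; if_then_else_; T)
import Data.Bool as Bool
open import Data.Bool.Properties using (not-involutive; ∨-comm; ∧-zeroʳ)
open import Data.Empty using (⊥; ⊥-elim)
open import Data.Fin as Fin using (Fin; zero; suc; toℕ; fromℕ; fromℕ<; inject≤; splitAt; _↑ˡ_; _↑ʳ_)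
open import Data.Fin using (combine; remQuot; quotient; remainder; finToFun; funToFin)
open import Data.Fin.Properties using (splitAt-↑ˡ; splitAt-↑ʳ; ↑ˡ-injective; ↑ʳ-injective; inject≤-injective)
open import Data.Fin.Properties using (toℕ<n; toℕ-fromℕ; toℕ-fromℕ<; fromℕ<-toℕ; toℕ-inject≤; injective⇒≤)
open import Data.Fin.Properties using (combine-injective; remQuot-combine; finToFun-funToFin; funToFin-finToFin)
open import Data.Fin.Properties using (+↔⊎; *↔×; 2↔Bool)
import Data.Fin.Properties as Finₚ
open import Data.List using (List; []; _∷_; length; lookup; map; _++_; _ʳ++_; allFin; filterᵇ)
open import Data.List.Membership.Propositional using (_∈_)
open import Data.List.Membership.Propositional.Properties using (∈-allFin; ∈-lookup; ∈-++⁺ˡ; ∈-++⁺ʳ; ∈-++⁻; ∈-map⁺; ∈-map⁻)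
open import Data.List.Properties using (∷-injective)
open import Data.List.Relation.Unary.All as All using (All; []; _∷_)
open import Data.List.Relation.Unary.AllPairs using (AllPairs; []; _∷_)
open import Data.List.Relation.Unary.Any as Any using (Any; here; there; index)
open import Data.List.Relation.Unary.Any.Properties using (lookup-index)
open import Data.Nat using (ℕ; zero; suc; _+_; _*_; _^_; _∸_; _≤_; _<_; _⊔_; z≤n; s≤s; _≤ᵇ_; _≡ᵇ_; _<?_; _/_; _%_)
open import Data.Nat.Properties
open import Data.Product using (Σ; _×_; _,_; ∃; ∃₂; proj₁; proj₂)
open import Data.Product.Function.NonDependent.Propositional using (_×-↔_)
open import Data.Sum using (_⊎_; inj₁; inj₂; [_,_]′)
open import Data.Sum.Function.Propositional using (_⊎-↔_)
open import Data.Unit using (tt)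
open import Function using (_∘_; _↔_; Inverse; mk↔ₛ′)
open import Function.Construct.Composition using (_↔-∘_)
open import Function.Construct.Identity using (↔-id)
open import Relation.Binary.PropositionalEquality hiding ([_])
open import Relation.Nullary using (¬_; does; yes; no)
open import Relation.Nullary.Decidable using (dec-true; dec-false)

-- Boolean connectives

∧-true : ∀ {a b} → a ∧ b ≡ true → a ≡ true × b ≡ true
∧-true {true} {true} _ = refl , refl

∧-intro : ∀ {a b} → a ≡ true → b ≡ true → a ∧ b ≡ true
∧-intro refl refl = refl

not-true : ∀ {b} → not b ≡ true → b ≡ false
not-true {false} _ = refl

not-false : ∀ {b} → not b ≡ false → b ≡ true
not-false {true} _ = refl

true≢false : true ≢ false
true≢false ()

-- The order of games

infix 4 _≼_ _⊲_ _≋_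

mutual
  _≼_ : Game → Game → Set
  mk m L n R ≼ mk m' L' n' R' =
    (∀ i → L i ⊲ mk m' L' n' R') × (∀ j → mk m L n R ⊲ R' j)

  -- The positive form of "not `H ≼ G`": it names a winning first move of Left in the difference
  -- `H - G`, which is a Right option of `G` or a Left option of `H`.
  _⊲_ : Game → Game → Set
  mk m L n R ⊲ mk m' L' n' R' =
    (∃ λ j → R j ≼ mk m' L' n' R') ⊎ (∃ λ i → mk m L n R ≼ L' i)

_≋_ : Game → Game → Set
G ≋ H = G ≼ H × H ≼ G

leftSize rightSize : Game → ℕ
leftSize  (mk m _ _ _) = m
rightSize (mk _ _ n _) = n

leftOption : (G : Game) → Fin (leftSize G) → Game
leftOption (mk _ L _ _) = L

rightOption : (G : Game) → Fin (rightSize G) → Game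
rightOption (mk _ _ _ R) = R

≼-left : ∀ G H → G ≼ H → ∀ i → leftOption G i ⊲ H
≼-left (mk _ _ _ _) (mk _ _ _ _) = proj₁

≼-right : ∀ G H → G ≼ H → ∀ j → G ⊲ rightOption H j
≼-right (mk _ _ _ _) (mk _ _ _ _) = proj₂

≼-intro : ∀ G H → (∀ i → leftOption G i ⊲ H) → (∀ j → G ⊲ rightOption H j) → G ≼ H
≼-intro (mk _ _ _ _) (mk _ _ _ _) = _,_

⊲-elim : ∀ G H → G ⊲ H → (∃ λ j → rightOption G j ≼ H) ⊎ (∃ λ i → G ≼ leftOption H i)
⊲-elim (mk _ _ _ _) (mk _ _ _ _) p = p

⊲-byRight : ∀ G H j → rightOption G j ≼ H → G ⊲ H
⊲-byRight (mk _ _ _ _) (mk _ _ _ _) j p = inj₁ (j , p)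

⊲-byLeft : ∀ G H i → G ≼ leftOption H i → G ⊲ H
⊲-byLeft (mk _ _ _ _) (mk _ _ _ _) i p = inj₂ (i , p)

≼-refl : ∀ G → G ≼ G
≼-refl G@(mk m L n R) =
  (λ i → ⊲-byLeft (L i) G i (≼-refl (L i))) , (λ j → ⊲-byRight G (R j) j (≼-refl (R j)))

mutual
  ≼-trans : ∀ G H K → G ≼ H → H ≼ K → G ≼ K
  ≼-trans G@(mk _ L _ _) H@(mk _ _ _ _) K@(mk _ _ _ R) p q =
    (λ i → ⊲-≼-trans (L i) H K (proj₁ p i) q) , (λ j → ≼-⊲-trans G H (R j) p (proj₂ q j))

  ⊲-≼-trans : ∀ G H K → G ⊲ H → H ≼ K → G ⊲ K
  ⊲-≼-trans G@(mk _ _ _ R) H@(mk _ _ _ _) K@(mk _ _ _ _) (inj₁ (j , p)) q = ⊲-byRight G K j (≼-trans (R j) H K p q)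
  ⊲-≼-trans G@(mk _ _ _ _) H@(mk _ L _ _) K@(mk _ _ _ _) (inj₂ (i , p)) q = ≼-⊲-trans G (L i) K p (proj₁ q i)

  ≼-⊲-trans : ∀ G H K → G ≼ H → H ⊲ K → G ⊲ K
  ≼-⊲-trans G@(mk _ _ _ _) H@(mk _ _ _ R) K@(mk _ _ _ _) p (inj₁ (j , q)) = ⊲-≼-trans G (R j) K (proj₂ p j) q
  ≼-⊲-trans G@(mk _ _ _ _) H@(mk _ _ _ _) K@(mk _ L _ _) p (inj₂ (i , q)) = inj₂ (i , ≼-trans G H (L i) p q)

≼⇒¬⊲ : ∀ G H → G ≼ H → ¬ (H ⊲ G)
≼⇒¬⊲ G@(mk _ _ _ _) (mk _ _ _ R) p (inj₁ (j , q)) = ≼⇒¬⊲ (R j) G q (proj₂ p j)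
≼⇒¬⊲ (mk _ L _ _) H@(mk _ _ _ _) p (inj₂ (i , q)) = ≼⇒¬⊲ H (L i) q (proj₁ p i)

≋-refl : ∀ G → G ≋ G
≋-refl G = ≼-refl G , ≼-refl G

≋-sym : ∀ {G H} → G ≋ H → H ≋ G
≋-sym (p , q) = q , p

≋-trans : ∀ {G H K} → G ≋ H → H ≋ K → G ≋ K
≋-trans {G} {H} {K} (p , p') (q , q') = ≼-trans G H K p q , ≼-trans K H G q' p'

≡⇒≼ : ∀ {G H} → G ≡ H → G ≼ H
≡⇒≼ {G} refl = ≼-refl G

-- Deciding the order

anyFin-true : ∀ m (f : Fin m → Bool) → anyFin m f ≡ true → ∃ λ i → f i ≡ true
anyFin-true (suc m) f e with f zero in eq
... | true  = zero , eq
... | false with i , p ← anyFin-true m (f ∘ suc) e = suc i , p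

anyFin-false : ∀ m (f : Fin m → Bool) → anyFin m f ≡ false → ∀ i → f i ≡ false
anyFin-false (suc m) f e i with f zero in eq
anyFin-false (suc m) f e zero    | false = eq
anyFin-false (suc m) f e (suc i) | false = anyFin-false m (f ∘ suc) e i

anyFin-intro : ∀ m (f : Fin m → Bool) i → f i ≡ true → anyFin m f ≡ true
anyFin-intro (suc m) f zero    e rewrite e = refl
anyFin-intro (suc m) f (suc i) e with f zero
... | true  = refl
... | false = anyFin-intro m (f ∘ suc) i e

anyFin-cong : ∀ m {f g : Fin m → Bool} → (∀ i → f i ≡ g i) → anyFin m f ≡ anyFin m g
anyFin-cong zero    e = refl
anyFin-cong (suc m) e = cong₂ _∨_ (e zero) (anyFin-cong m (e ∘ suc))

-- Since `L i ⊲ H` is the negation of `H ≼ L i`, a single recursive function decides both relations.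
leb : Game → Game → Bool
leb G@(mk m L _ _) H@(mk _ _ n R) =
  not (anyFin m (λ i → leb H (L i))) ∧ not (anyFin n (λ j → leb (R j) G))

private
  ∧-false : ∀ {a b} → a ∧ b ≡ false → a ≡ false ⊎ b ≡ false
  ∧-false {false} _ = inj₁ refl
  ∧-false {true} {false} _ = inj₂ refl

mutual
  leb-true : ∀ G H → leb G H ≡ true → G ≼ H
  leb-true G@(mk m L _ _) H@(mk _ _ n R) e =
    (λ i → leb-false H (L i) (anyFin-false m _ (not-true (proj₁ (∧-true e))) i)) ,
    (λ j → leb-false (R j) G (anyFin-false n _ (not-true (proj₂ (∧-true e))) j))

  leb-false : ∀ G H → leb G H ≡ false → H ⊲ G
  leb-false G@(mk m L _ _) H@(mk _ _ n R) e =
    [ (λ p → ⊲-byLeft H G (proj₁ (anyFin-true m _ (not-false p)))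
               (leb-true H (L (proj₁ (anyFin-true m _ (not-false p)))) (proj₂ (anyFin-true m _ (not-false p)))))
    , (λ p → ⊲-byRight H G (proj₁ (anyFin-true n _ (not-false p)))
               (leb-true (R (proj₁ (anyFin-true n _ (not-false p)))) G (proj₂ (anyFin-true n _ (not-false p))))) ]′
    (∧-false e)

≼⇒leb : ∀ G H → G ≼ H → leb G H ≡ true
≼⇒leb G H p with leb G H in e
... | true  = refl
... | false = ⊥-elim (≼⇒¬⊲ G H p (leb-false G H e))

⊲⇒leb : ∀ G H → H ⊲ G → leb G H ≡ false
⊲⇒leb G H p with leb G H in e
... | false = refl
... | true  = ⊥-elim (≼⇒¬⊲ G H (leb-true G H e) p)

-- Equality of games in terms of the order

neg : Game → Game
neg (mk m L n R) = mk n (neg ∘ R) m (neg ∘ L)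

anyFin-+ : ∀ m n (f : Fin m → Bool) (g : Fin n → Bool) →
  anyFin (m + n) (λ i → [ f , g ]′ (splitAt m i)) ≡ anyFin m f ∨ anyFin n g
anyFin-+ zero    n f g = refl
anyFin-+ (suc m) n f g with f zero
... | true  = refl
... | false = trans (anyFin-cong (m + n) step) (anyFin-+ m n (f ∘ suc) g)
  where
  step : ∀ i → [ f , g ]′ (splitAt (suc m) (suc i)) ≡ [ f ∘ suc , g ]′ (splitAt m i)
  step i with splitAt m i
  ... | inj₁ _ = refl
  ... | inj₂ _ = refl

private
  distr : ∀ {A : Set} (h : Game → A) {m n} (f : Fin m → Game) (g : Fin n → Game) (s : Fin m ⊎ Fin n) →
    h ([ f , g ]′ s) ≡ [ h ∘ f , h ∘ g ]′ s
  distr h f g (inj₁ _) = refl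
  distr h f g (inj₂ _) = refl

leftWinsFirst-⊕ : ∀ G H → leftWinsFirst (G ⊕ H) ≡
  anyFin (leftSize G) (λ i → not (rightWinsFirst (leftOption G i ⊕ H))) ∨
  anyFin (leftSize H) (λ i → not (rightWinsFirst (G ⊕ leftOption H i)))
leftWinsFirst-⊕ (mk m L n R) (mk m' L' n' R') =
  trans (anyFin-cong (m + m') (λ i → distr (not ∘ rightWinsFirst) _ _ (splitAt m i))) (anyFin-+ m m' _ _)

rightWinsFirst-⊕ : ∀ G H → rightWinsFirst (G ⊕ H) ≡
  anyFin (rightSize G) (λ i → not (leftWinsFirst (rightOption G i ⊕ H))) ∨
  anyFin (rightSize H) (λ i → not (leftWinsFirst (G ⊕ rightOption H i)))
rightWinsFirst-⊕ (mk m L n R) (mk m' L' n' R') =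
  trans (anyFin-cong (n + n') (λ i → distr (not ∘ leftWinsFirst) _ _ (splitAt n i))) (anyFin-+ n n' _ _)

private
  deMorgan : ∀ a b → b ∨ a ≡ not (not a ∧ not b)
  deMorgan true  true  = refl
  deMorgan true  false = refl
  deMorgan false true  = refl
  deMorgan false false = refl

mutual
  -- A winning first move of Left in `Y - Z` goes to a Left option of `Y` that is at least `Z`, or
  -- to a Right option of `Z` that is at most `Y`. These are exactly the failures that `leb Y Z`
  -- looks for.
  leftWinsFirst-diff : ∀ Z Y → leftWinsFirst (neg Z ⊕ Y) ≡ not (leb Y Z)
  leftWinsFirst-diff Z@(mk m L n R) Y@(mk m' L' n' R') =
    trans (leftWinsFirst-⊕ (neg Z) Y)
      (trans (cong₂ _∨_
               (anyFin-cong n (λ j → trans (cong not (rightWinsFirst-diff (R j) Y)) (not-involutive _)))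
               (anyFin-cong m' (λ i → trans (cong not (rightWinsFirst-diff Z (L' i))) (not-involutive _))))
             (deMorgan (anyFin m' _) _))

  rightWinsFirst-diff : ∀ Z Y → rightWinsFirst (neg Z ⊕ Y) ≡ not (leb Z Y)
  rightWinsFirst-diff Z@(mk m L n R) Y@(mk m' L' n' R') =
    trans (rightWinsFirst-⊕ (neg Z) Y)
      (trans (cong₂ _∨_
               (anyFin-cong m (λ i → trans (cong not (leftWinsFirst-diff (L i) Y)) (not-involutive _)))
               (anyFin-cong n' (λ j → trans (cong not (leftWinsFirst-diff Z (R' j))) (not-involutive _))))
             (trans (∨-comm (anyFin m _) _) (deMorgan (anyFin m _) _)))

-- The single test game `neg Z` suffices: the second player wins `neg Z ⊕ Z`, hence also
-- `neg Z ⊕ Y`.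
≈⇒≋ : ∀ {Y Z} → Y ≈ Z → Y ≋ Z
≈⇒≋ {Y} {Z} e =
  leb-true Y Z (not-false (trans (sym (leftWinsFirst-diff Z Y))
    (trans (cong proj₁ (e (neg Z))) (trans (leftWinsFirst-diff Z Z) (cong not (≼⇒leb Z Z (≼-refl Z))))))) ,
  leb-true Z Y (not-false (trans (sym (rightWinsFirst-diff Z Y))
    (trans (cong proj₂ (e (neg Z))) (trans (rightWinsFirst-diff Z Z) (cong not (≼⇒leb Z Z (≼-refl Z)))))))

⊕-leftˡ : ∀ G H i → ∃ λ k → leftOption (G ⊕ H) k ≡ leftOption G i ⊕ H
⊕-leftˡ (mk m L n R) (mk m' L' n' R') i = i ↑ˡ m' , cong [ _ , _ ]′ (splitAt-↑ˡ m i m')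

⊕-leftʳ : ∀ G H i → ∃ λ k → leftOption (G ⊕ H) k ≡ G ⊕ leftOption H i
⊕-leftʳ (mk m L n R) (mk m' L' n' R') i = m ↑ʳ i , cong [ _ , _ ]′ (splitAt-↑ʳ m m' i)

⊕-rightˡ : ∀ G H i → ∃ λ k → rightOption (G ⊕ H) k ≡ rightOption G i ⊕ H
⊕-rightˡ (mk m L n R) (mk m' L' n' R') i = i ↑ˡ n' , cong [ _ , _ ]′ (splitAt-↑ˡ n i n')

⊕-rightʳ : ∀ G H i → ∃ λ k → rightOption (G ⊕ H) k ≡ G ⊕ rightOption H i
⊕-rightʳ (mk m L n R) (mk m' L' n' R') i = n ↑ʳ i , cong [ _ , _ ]′ (splitAt-↑ʳ n n' i)

mutual
  ⊕-mono-≼ : ∀ X Y Z → Y ≼ Z → X ⊕ Y ≼ X ⊕ Z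
  ⊕-mono-≼ X@(mk m L n R) Y@(mk m' L' n' R') Z@(mk m'' L'' n'' R'') p = lefts , rights
    where
    lefts : ∀ i → leftOption (X ⊕ Y) i ⊲ X ⊕ Z
    lefts i with splitAt m i
    ... | inj₁ a with k , e ← ⊕-leftˡ X Z a =
      ⊲-byLeft (L a ⊕ Y) (X ⊕ Z) k (subst (L a ⊕ Y ≼_) (sym e) (⊕-mono-≼ (L a) Y Z p))
    ... | inj₂ b = ⊕-mono-⊲ X (L' b) Z (proj₁ p b)
    rights : ∀ j → X ⊕ Y ⊲ rightOption (X ⊕ Z) j
    rights j with splitAt n j
    ... | inj₁ a with k , e ← ⊕-rightˡ X Y a =
      ⊲-byRight (X ⊕ Y) (R a ⊕ Z) k (subst (_≼ R a ⊕ Z) (sym e) (⊕-mono-≼ (R a) Y Z p))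
    ... | inj₂ b = ⊕-mono-⊲ X Y (R'' b) (proj₂ p b)

  ⊕-mono-⊲ : ∀ X Y Z → Y ⊲ Z → X ⊕ Y ⊲ X ⊕ Z
  ⊕-mono-⊲ X@(mk m L n R) Y@(mk m' L' n' R') Z@(mk m'' L'' n'' R'') (inj₁ (j , p)) with k , e ← ⊕-rightʳ X Y j =
    inj₁ (k , subst (_≼ X ⊕ Z) (sym e) (⊕-mono-≼ X (R' j) Z p))
  ⊕-mono-⊲ X@(mk m L n R) Y@(mk m' L' n' R') Z@(mk m'' L'' n'' R'') (inj₂ (i , p)) with k , e ← ⊕-leftʳ X Z i =
    inj₂ (k , subst (X ⊕ Y ≼_) (sym e) (⊕-mono-≼ X Y (L'' i) p))

0ᵍ : Game
0ᵍ = mk 0 (λ ()) 0 (λ ())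

mutual
  leftWinsFirst-0 : ∀ G → leftWinsFirst G ≡ not (leb G 0ᵍ)
  leftWinsFirst-0 (mk m L n R) =
    trans (anyFin-cong m (λ i → trans (cong not (rightWinsFirst-0 (L i))) (not-involutive _))) (lem _)
    where
    lem : ∀ b → b ≡ not (not b ∧ true)
    lem true  = refl
    lem false = refl

  rightWinsFirst-0 : ∀ G → rightWinsFirst G ≡ not (leb 0ᵍ G)
  rightWinsFirst-0 (mk m L n R) =
    trans (anyFin-cong n (λ i → trans (cong not (leftWinsFirst-0 (R i))) (not-involutive _))) (sym (not-involutive _))

leb-cong : ∀ {G H G' H'} → G ≋ G' → H ≋ H' → leb G H ≡ leb G' H'
leb-cong {G} {H} {G'} {H'} (p , p') (q , q') with leb G' H' in e
... | true  = ≼⇒leb G H (≼-trans G G' H p (≼-trans G' H' H (leb-true G' H' e) q'))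
... | false = ⊲⇒leb G H (≼-⊲-trans H H' G q (⊲-≼-trans H' G' G (leb-false G' H' e) p'))

-- Outcomes are comparisons with `0ᵍ`, and adding `X` preserves the order.
≋⇒≈ : ∀ {Y Z} → Y ≋ Z → Y ≈ Z
≋⇒≈ {Y} {Z} (p , q) X = cong₂ _,_
  (trans (leftWinsFirst-0 (X ⊕ Y)) (trans (cong not (leb-cong e (≋-refl 0ᵍ))) (sym (leftWinsFirst-0 (X ⊕ Z)))))
  (trans (rightWinsFirst-0 (X ⊕ Y)) (trans (cong not (leb-cong (≋-refl 0ᵍ) e)) (sym (rightWinsFirst-0 (X ⊕ Z)))))
  where
  e : X ⊕ Y ≋ X ⊕ Z
  e = ⊕-mono-≼ X Y Z p , ⊕-mono-≼ X Z Y q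

≋? : Game → Game → Bool
≋? G H = leb G H ∧ leb H G

≋?-sound : ∀ G H → ≋? G H ≡ true → G ≋ H
≋?-sound G H e with p , q ← ∧-true e = leb-true G H p , leb-true H G q

≋?-complete : ∀ G H → G ≋ H → ≋? G H ≡ true
≋?-complete G H (p , q) rewrite ≼⇒leb G H p | ≼⇒leb H G q = refl

-- Birthdays and integers

-- The bound `birthday G ≤ b`, unfolded along the game tree to avoid maxima.
Born : ℕ → Game → Set
Born zero    (mk m L n R) = m ≡ 0 × n ≡ 0
Born (suc b) (mk m L n R) = (∀ i → Born b (L i)) × (∀ j → Born b (R j))

private
  maxFin-≤ : ∀ m (f : Fin m → ℕ) {b} → maxFin m f ≤ b → ∀ i → f i ≤ b
  maxFin-≤ (suc m) f p zero    = m⊔n≤o⇒m≤o (f zero) _ p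
  maxFin-≤ (suc m) f p (suc i) = maxFin-≤ m (f ∘ suc) (m⊔n≤o⇒n≤o (f zero) _ p) i

  ≤-maxFin : ∀ m (f : Fin m → ℕ) {b} → (∀ i → f i ≤ b) → maxFin m f ≤ b
  ≤-maxFin zero    f p = z≤n
  ≤-maxFin (suc m) f p = ⊔-lub (p zero) (≤-maxFin m (f ∘ suc) (p ∘ suc))

birthday⇒Born : ∀ b G → birthday G ≤ b → Born b G
birthday⇒Born zero    (mk zero L zero R) p = refl , refl
birthday⇒Born zero    (mk zero L (suc n) R) ()
birthday⇒Born zero    (mk (suc m) L n R) ()
birthday⇒Born (suc b) (mk zero L zero R) p = (λ ()) , (λ ())
birthday⇒Born (suc b) (mk zero L (suc n) R) (s≤s p) =
  (λ ()) , λ j → birthday⇒Born b (R j) (maxFin-≤ (suc n) (birthday ∘ R) p j)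
birthday⇒Born (suc b) (mk (suc m) L n R) (s≤s p) =
  (λ i → birthday⇒Born b (L i) (maxFin-≤ (suc m) (birthday ∘ L) (m⊔n≤o⇒m≤o (maxFin (suc m) (birthday ∘ L)) (maxFin n (birthday ∘ R)) p) i)) ,
  (λ j → birthday⇒Born b (R j) (maxFin-≤ n (birthday ∘ R) (m⊔n≤o⇒n≤o (maxFin (suc m) (birthday ∘ L)) (maxFin n (birthday ∘ R)) p) j))

Born⇒birthday : ∀ b G → Born b G → birthday G ≤ b
Born⇒birthday zero    (mk m L n R) (refl , refl) = z≤n
Born⇒birthday (suc b) (mk zero L zero R) p = z≤n
Born⇒birthday (suc b) (mk zero L (suc n) R) (p , q) =
  s≤s (≤-maxFin (suc n) (birthday ∘ R) (λ j → Born⇒birthday b (R j) (q j)))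
Born⇒birthday (suc b) (mk (suc m) L n R) (p , q) =
  s≤s (⊔-lub (≤-maxFin (suc m) (birthday ∘ L) (λ i → Born⇒birthday b (L i) (p i)))
             (≤-maxFin n (birthday ∘ R) (λ j → Born⇒birthday b (R j) (q j))))

Born-left : ∀ b G → Born (suc b) G → ∀ i → Born b (leftOption G i)
Born-left b (mk _ _ _ _) = proj₁

Born-right : ∀ b G → Born (suc b) G → ∀ j → Born b (rightOption G j)
Born-right b (mk _ _ _ _) = proj₂

Born-suc : ∀ b G → Born b G → Born (suc b) G
Born-suc zero    (mk m L n R) (refl , refl) = (λ ()) , (λ ())
Born-suc (suc b) (mk m L n R) (p , q) = (λ i → Born-suc b (L i) (p i)) , (λ j → Born-suc b (R j) (q j))

pos neg[_] : ℕ → Game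
pos zero    = 0ᵍ
pos (suc n) = mk 1 (λ _ → pos n) 0 (λ ())
neg[ zero ]  = 0ᵍ
neg[ suc n ] = mk 0 (λ ()) 1 (λ _ → neg[ n ])

Born-neg[] : ∀ n → Born n neg[ n ]
Born-neg[] zero    = refl , refl
Born-neg[] (suc n) = (λ ()) , (λ _ → Born-neg[] n)

Born-pos : ∀ n → Born n (pos n)
Born-pos zero    = refl , refl
Born-pos (suc n) = (λ _ → Born-pos n) , (λ ())

Born⇒≽ : ∀ b G → Born b G → neg[ b ] ≼ G
Born⇒≽ zero    (mk m L n R) (refl , refl) = (λ ()) , (λ ())
Born⇒≽ (suc b) (mk m L n R) (p , q) = (λ ()) , (λ j → ⊲-byRight neg[ suc b ] (R j) zero (Born⇒≽ b (R j) (q j)))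

Born⇒≼ : ∀ b G → Born b G → G ≼ pos b
Born⇒≼ zero    (mk m L n R) (refl , refl) = (λ ()) , (λ ())
Born⇒≼ (suc b) (mk m L n R) (p , q) = (λ i → ⊲-byLeft (L i) (pos (suc b)) zero (Born⇒≼ b (L i) (p i))) , (λ ())

-- Counting

bit : Bool → ℕ
bit true  = 1
bit false = 0

count : ∀ {n} → (Fin n → Bool) → ℕ
count {zero}  p = 0
count {suc n} p = bit (p zero) + count (p ∘ suc)

infix 4 _⊑_
_⊑_ : ∀ {A : Set} → (A → Bool) → (A → Bool) → Set
p ⊑ q = ∀ i → p i ≡ true → q i ≡ true

private
  bit-mono : ∀ {a b} → (a ≡ true → b ≡ true) → bit a ≤ bit b
  bit-mono {false} _ = z≤n
  bit-mono {true}  f rewrite f refl = ≤-refl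

count-mono : ∀ {n} {p q : Fin n → Bool} → p ⊑ q → count p ≤ count q
count-mono {zero}  s = z≤n
count-mono {suc n} s = +-mono-≤ (bit-mono (s zero)) (count-mono (s ∘ suc))

count-< : ∀ {n} {p q : Fin n → Bool} → p ⊑ q → ∀ v → p v ≡ false → q v ≡ true → count p < count q
count-< {suc n} s zero    e f rewrite e | f = s≤s (count-mono (s ∘ suc))
count-< {suc n} {p} {q} s (suc v) e f =
  subst (_≤ count q) (+-suc (bit (p zero)) _) (+-mono-≤ (bit-mono (s zero)) (count-< (s ∘ suc) v e f))

count-≤ : ∀ {n} (p : Fin n → Bool) → count p ≤ n
count-≤ {zero}  p = z≤n
count-≤ {suc n} p = +-mono-≤ {bit (p zero)} {1} (bit-mono {b = true} (λ _ → refl)) (count-≤ (p ∘ suc))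

count-pos : ∀ {n} {p : Fin n → Bool} v → p v ≡ true → 1 ≤ count p
count-pos {suc n} zero    e rewrite e = s≤s z≤n
count-pos {suc n} (suc v) e = ≤-trans (count-pos v e) (m≤n+m _ _)

-- Moves of a placement game

-- The option lists in the definition of placeGame are local to it; the
-- underscores stand for statements about them, for an arbitrary list of
-- vertices in place of allFin.
mutual
  leftMove-suc : ∀ D k S (i : Fin (leftSize (placeGame D (suc k) S))) → ∃ λ v →
    S v ≡ true × blue D v ≡ true × leftOption (placeGame D (suc k) S) i ≡ placeGame D k (delete D v S)
  leftMove-suc D k S with allFin (size D)
  ... | vs = leftMove-aux D k S vs

  leftMove-aux : ∀ D k S vs → _
  leftMove-aux D k S (v ∷ vs) i with S v in e₁ | Bool._≟_ (blue D v) true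
  leftMove-aux D k S (v ∷ vs) zero    | true | yes e₂ = v , e₁ , e₂ , refl
  leftMove-aux D k S (v ∷ vs) (suc i) | true | yes e₂ = leftMove-aux D k S vs i
  ... | true  | no _  = leftMove-aux D k S vs i
  ... | false | yes _ = leftMove-aux D k S vs i
  ... | false | no _  = leftMove-aux D k S vs i

mutual
  rightMove-suc : ∀ D k S (i : Fin (rightSize (placeGame D (suc k) S))) → ∃ λ v →
    S v ≡ true × blue D v ≡ false × rightOption (placeGame D (suc k) S) i ≡ placeGame D k (delete D v S)
  rightMove-suc D k S with allFin (size D)
  ... | vs = rightMove-aux D k S vs

  rightMove-aux : ∀ D k S vs → _
  rightMove-aux D k S (v ∷ vs) i with S v in e₁ | Bool._≟_ (blue D v) false
  rightMove-aux D k S (v ∷ vs) zero    | true | yes e₂ = v , e₁ , e₂ , refl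
  rightMove-aux D k S (v ∷ vs) (suc i) | true | yes e₂ = rightMove-aux D k S vs i
  ... | true  | no _  = rightMove-aux D k S vs i
  ... | false | yes _ = rightMove-aux D k S vs i
  ... | false | no _  = rightMove-aux D k S vs i

mutual
  blueMove-∈ : ∀ D k S v → v ∈ allFin (size D) → S v ≡ true → blue D v ≡ true →
    ∃ λ i → leftOption (placeGame D (suc k) S) i ≡ placeGame D k (delete D v S)
  blueMove-∈ D k S v with allFin (size D)
  ... | vs = blueMove-aux D k S v vs

  blueMove-aux : ∀ D k S v vs → _
  blueMove-aux D k S v (v ∷ vs) (here refl) e₁ e₂ with S v | Bool._≟_ (blue D v) true
  ... | true  | yes _ = zero , refl
  ... | true  | no ¬p = ⊥-elim (¬p e₂)
  blueMove-aux D k S v (v ∷ vs) (here refl) () e₂ | false | _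
  blueMove-aux D k S v (u ∷ vs) (there p) e₁ e₂ with S u ∧ does (Bool._≟_ (blue D u) true) | blueMove-aux D k S v vs p e₁ e₂
  ... | true  | i , q = suc i , q
  ... | false | i , q = i , q

mutual
  redMove-∈ : ∀ D k S v → v ∈ allFin (size D) → S v ≡ true → blue D v ≡ false →
    ∃ λ i → rightOption (placeGame D (suc k) S) i ≡ placeGame D k (delete D v S)
  redMove-∈ D k S v with allFin (size D)
  ... | vs = redMove-aux D k S v vs

  redMove-aux : ∀ D k S v vs → _
  redMove-aux D k S v (v ∷ vs) (here refl) e₁ e₂ with S v | Bool._≟_ (blue D v) false
  ... | true  | yes _ = zero , refl
  ... | true  | no ¬p = ⊥-elim (¬p e₂)
  redMove-aux D k S v (v ∷ vs) (here refl) () e₂ | false | _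
  redMove-aux D k S v (u ∷ vs) (there p) e₁ e₂ with S u ∧ does (Bool._≟_ (blue D u) false) | redMove-aux D k S v vs p e₁ e₂
  ... | true  | i , q = suc i , q
  ... | false | i , q = i , q

leftMove : ∀ D k S (i : Fin (leftSize (placeGame D k S))) → ∃₂ λ k' v → k ≡ suc k' ×
  S v ≡ true × blue D v ≡ true × leftOption (placeGame D k S) i ≡ placeGame D k' (delete D v S)
leftMove D (suc k) S i with v , p ← leftMove-suc D k S i = k , v , refl , p

rightMove : ∀ D k S (i : Fin (rightSize (placeGame D k S))) → ∃₂ λ k' v → k ≡ suc k' ×
  S v ≡ true × blue D v ≡ false × rightOption (placeGame D k S) i ≡ placeGame D k' (delete D v S)
rightMove D (suc k) S i with v , p ← rightMove-suc D k S i = k , v , refl , p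

blueMove : ∀ D k S v → S v ≡ true → blue D v ≡ true →
  ∃ λ i → leftOption (placeGame D (suc k) S) i ≡ placeGame D k (delete D v S)
blueMove D k S v = blueMove-∈ D k S v (∈-allFin v)

redMove : ∀ D k S v → S v ≡ true → blue D v ≡ false →
  ∃ λ i → rightOption (placeGame D (suc k) S) i ≡ placeGame D k (delete D v S)
redMove D k S v = redMove-∈ D k S v (∈-allFin v)

delete-⊑ : ∀ D v S → delete D v S ⊑ S
delete-⊑ D v S w e = proj₁ (∧-true e)

delete-self : ∀ D v S → delete D v S v ≡ false
delete-self D v S with Fin._≟_ v v
... | yes _ = ∧-zeroʳ (S v)
... | no ¬p = ⊥-elim (¬p refl)

delete-mono : ∀ D v S T → ∀ w → (S w ≡ true → T w ≡ true) → delete D v S w ≡ true → delete D v T w ≡ true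
delete-mono D v S T w f e with p , q ← ∧-true {S w} e rewrite f p = q

count-delete : ∀ D v S → S v ≡ true → count (delete D v S) < count S
count-delete D v S e = count-< (delete-⊑ D v S) v (delete-self D v S) e

private
  fuel : ∀ D k v S → S v ≡ true → count S ≤ suc k → count (delete D v S) ≤ k
  fuel D k v S e p = ≤-pred (≤-trans (count-delete D v S e) p)

-- Left, playing second in the difference, answers a blue move on the smaller side by a blue move on
-- the larger side and a red move on the larger side by a red one on the smaller, preserving `ℛ`.
-- The fuel bounds the number of remaining vertices, so it cannot be exhausted while an answer
-- exists.
simulation : ∀ D D' (ℛ : (Fin (size D) → Bool) → (Fin (size D') → Bool) → Set) →
  (∀ S S' → ℛ S S' → ∀ v → S v ≡ true → blue D v ≡ true →
     ∃ λ v' → S' v' ≡ true × blue D' v' ≡ true × ℛ (delete D v S) (delete D' v' S')) →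
  (∀ S S' → ℛ S S' → ∀ v' → S' v' ≡ true → blue D' v' ≡ false →
     ∃ λ v → S v ≡ true × blue D v ≡ false × ℛ (delete D v S) (delete D' v' S')) →
  ∀ k k' S S' → count S ≤ k → count S' ≤ k' → ℛ S S' → placeGame D k S ≼ placeGame D' k' S'
simulation D D' ℛ fwd bwd = go
  where
  go : ∀ k k' S S' → count S ≤ k → count S' ≤ k' → ℛ S S' → placeGame D k S ≼ placeGame D' k' S'
  go k k' S S' c c' r = ≼-intro _ _ (lefts k k' c c') (rights k k' c c')
    where
    lefts : ∀ k k' → count S ≤ k → count S' ≤ k' → ∀ i → leftOption (placeGame D k S) i ⊲ placeGame D' k' S'
    lefts k k' c c' i with leftMove D k S i
    ... | k₁ , v , refl , s , b , e with fwd S S' r v s b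
    lefts k zero c c' i | k₁ , v , refl , s , b , e | v' , s' , b' , r' =
      ⊥-elim (1+n≰n (≤-trans (count-pos v' s') c'))
    lefts k (suc k') c c' i | k₁ , v , refl , s , b , e | v' , s' , b' , r' with j , e' ← blueMove D' k' S' v' s' b' =
      ⊲-byLeft _ _ j (subst₂ _≼_ (sym e) (sym e') (go k₁ k' _ _ (fuel D k₁ v S s c) (fuel D' k' v' S' s' c') r'))
    rights : ∀ k k' → count S ≤ k → count S' ≤ k' → ∀ i → placeGame D k S ⊲ rightOption (placeGame D' k' S') i
    rights k k' c c' i with rightMove D' k' S' i
    ... | k₁ , v' , refl , s' , b' , e' with bwd S S' r v' s' b'
    rights zero k' c c' i | k₁ , v' , refl , s' , b' , e' | v , s , b , r' =
      ⊥-elim (1+n≰n (≤-trans (count-pos v s) c))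
    rights (suc k) k' c c' i | k₁ , v' , refl , s' , b' , e' | v , s , b , r' with j , e ← redMove D k S v s b =
      ⊲-byRight _ _ j (subst₂ _≼_ (sym e) (sym e') (go k k₁ _ _ (fuel D k v S s c) (fuel D' k₁ v' S' s' c') r'))

-- Positions of a fixed digraph

module Position (D : Digraph) where

  Pos : Set
  Pos = Fin (size D) → Bool

  ⟦_⟧ : Pos → Game
  ⟦ S ⟧ = placeGame D (size D) S

  infixl 6 _∖_
  _∖_ : Pos → Fin (size D) → Pos
  S ∖ v = delete D v S

  -- Whatever the arcs of the extra vertices are, Left wins by mirroring.
  mono-fuel : ∀ k k' S S' → count S ≤ k → count S' ≤ k' →
    (∀ v → blue D v ≡ true → S v ≡ true → S' v ≡ true) →
    (∀ v → blue D v ≡ false → S' v ≡ true → S v ≡ true) → placeGame D k S ≼ placeGame D k' S'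
  mono-fuel k k' S S' c c' p q = simulation D D
    (λ S S' → (∀ v → blue D v ≡ true → S v ≡ true → S' v ≡ true) × (∀ v → blue D v ≡ false → S' v ≡ true → S v ≡ true))
    (λ { S S' (p , q) v s b → v , p v b s , b ,
         (λ w b' → delete-mono D v S S' w (p w b')) , (λ w b' → delete-mono D v S' S w (q w b')) })
    (λ { S S' (p , q) v s b → v , q v b s , b ,
         (λ w b' → delete-mono D v S S' w (p w b')) , (λ w b' → delete-mono D v S' S w (q w b')) })
    k k' S S' c c' (p , q)

  mono : ∀ S S' → (∀ v → blue D v ≡ true → S v ≡ true → S' v ≡ true) →
    (∀ v → blue D v ≡ false → S' v ≡ true → S v ≡ true) → ⟦ S ⟧ ≼ ⟦ S' ⟧
  mono S S' = mono-fuel _ _ S S' (count-≤ S) (count-≤ S')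

  ⟦⟧-cong : ∀ S S' → (∀ v → S v ≡ S' v) → ⟦ S ⟧ ≼ ⟦ S' ⟧
  ⟦⟧-cong S S' e = mono S S' (λ v _ s → trans (sym (e v)) s) (λ v _ s → trans (e v) s)

  private
    -- A move uses one unit of fuel. By `mono-fuel`, applied to the same position twice, the value
    -- does not depend on the fuel as long as it suffices, so every position may be given the full
    -- amount.
    refuel : ∀ k S v → size D ≡ suc k → S v ≡ true → placeGame D k (S ∖ v) ≋ ⟦ S ∖ v ⟧
    refuel k S v e s =
      mono-fuel _ _ _ _ c (count-≤ _) (λ _ _ x → x) (λ _ _ x → x) ,
      mono-fuel _ _ _ _ (count-≤ _) c (λ _ _ x → x) (λ _ _ x → x)
      where c = fuel D k v S s (≤-trans (count-≤ S) (≤-reflexive e))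

    blueMove′ : ∀ n → size D ≡ n → ∀ S v → S v ≡ true → blue D v ≡ true →
      ∃ λ i → leftOption (placeGame D n S) i ≋ ⟦ S ∖ v ⟧
    blueMove′ zero e S v s b = ⊥-elim (1+n≰n (≤-trans (count-pos v s) (subst (count S ≤_) e (count-≤ S))))
    blueMove′ (suc k) e S v s b with i , q ← blueMove D k S v s b =
      i , subst (_≋ ⟦ S ∖ v ⟧) (sym q) (refuel k S v e s)

    redMove′ : ∀ n → size D ≡ n → ∀ S v → S v ≡ true → blue D v ≡ false →
      ∃ λ i → rightOption (placeGame D n S) i ≋ ⟦ S ∖ v ⟧
    redMove′ zero e S v s b = ⊥-elim (1+n≰n (≤-trans (count-pos v s) (subst (count S ≤_) e (count-≤ S))))
    redMove′ (suc k) e S v s b with i , q ← redMove D k S v s b =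
      i , subst (_≋ ⟦ S ∖ v ⟧) (sym q) (refuel k S v e s)

    leftMove′ : ∀ S i → ∃ λ v → S v ≡ true × blue D v ≡ true × leftOption ⟦ S ⟧ i ≋ ⟦ S ∖ v ⟧
    leftMove′ S i with k , v , e , s , b , q ← leftMove D (size D) S i =
      v , s , b , subst (_≋ ⟦ S ∖ v ⟧) (sym q) (refuel k S v e s)

    rightMove′ : ∀ S i → ∃ λ v → S v ≡ true × blue D v ≡ false × rightOption ⟦ S ⟧ i ≋ ⟦ S ∖ v ⟧
    rightMove′ S i with k , v , e , s , b , q ← rightMove D (size D) S i =
      v , s , b , subst (_≋ ⟦ S ∖ v ⟧) (sym q) (refuel k S v e s)

  ≼-move : ∀ {H S} → ⟦ S ⟧ ≼ H → ∀ v → S v ≡ true → blue D v ≡ true → ⟦ S ∖ v ⟧ ⊲ H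
  ≼-move {H} {S} p v s b with i , q , q' ← blueMove′ _ refl S v s b =
    ≼-⊲-trans _ _ H q' (≼-left _ H p i)

  ≽-move : ∀ {H S} → H ≼ ⟦ S ⟧ → ∀ v → S v ≡ true → blue D v ≡ false → H ⊲ ⟦ S ∖ v ⟧
  ≽-move {H} {S} p v s b with i , q , q' ← redMove′ _ refl S v s b =
    ⊲-≼-trans H _ _ (≼-right H _ p i) q

  ⊲-byBlue : ∀ {H S} v → S v ≡ true → blue D v ≡ true → H ≼ ⟦ S ∖ v ⟧ → H ⊲ ⟦ S ⟧
  ⊲-byBlue {H} {S} v s b p with i , q , q' ← blueMove′ _ refl S v s b =
    ⊲-byLeft H _ i (≼-trans H _ _ p q')

  ⊲-byRed : ∀ {H S} v → S v ≡ true → blue D v ≡ false → ⟦ S ∖ v ⟧ ≼ H → ⟦ S ⟧ ⊲ H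
  ⊲-byRed {H} {S} v s b p with i , q , q' ← redMove′ _ refl S v s b =
    ⊲-byRight _ H i (≼-trans _ _ H q p)

  ⊲-elimBlue : ∀ {H S} → H ⊲ ⟦ S ⟧ → (∃ λ j → rightOption H j ≼ ⟦ S ⟧) ⊎
    (∃ λ v → S v ≡ true × blue D v ≡ true × H ≼ ⟦ S ∖ v ⟧)
  ⊲-elimBlue {H} {S} p with ⊲-elim H _ p
  ... | inj₁ q = inj₁ q
  ... | inj₂ (i , q) with v , s , b , r , _ ← leftMove′ S i = inj₂ (v , s , b , ≼-trans H _ _ q r)

  ⊲-elimRed : ∀ {H S} → ⟦ S ⟧ ⊲ H → (∃ λ i → ⟦ S ⟧ ≼ leftOption H i) ⊎
    (∃ λ v → S v ≡ true × blue D v ≡ false × ⟦ S ∖ v ⟧ ≼ H)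
  ⊲-elimRed {H} {S} p with ⊲-elim _ H p
  ... | inj₂ q = inj₁ q
  ... | inj₁ (i , q) with v , s , b , _ , r ← rightMove′ S i = inj₂ (v , s , b , ≼-trans _ _ H r q)

  ≼-intro-⟦⟧ : ∀ {H S} → (∀ v → S v ≡ true → blue D v ≡ true → ⟦ S ∖ v ⟧ ⊲ H) →
    (∀ j → ⟦ S ⟧ ⊲ rightOption H j) → ⟦ S ⟧ ≼ H
  ≼-intro-⟦⟧ {H} {S} p q = ≼-intro _ H (λ i → let v , s , b , r , _ = leftMove′ S i in ≼-⊲-trans _ _ H r (p v s b)) q

  ≽-intro-⟦⟧ : ∀ {H S} → (∀ v → S v ≡ true → blue D v ≡ false → H ⊲ ⟦ S ∖ v ⟧) →
    (∀ i → leftOption H i ⊲ ⟦ S ⟧) → H ≼ ⟦ S ⟧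
  ≽-intro-⟦⟧ {H} {S} p q = ≼-intro H _ q (λ i → let v , s , b , _ , r = rightMove′ S i in ⊲-≼-trans H _ _ (p v s b) r)

-- Double counting

count-some : ∀ {n} (p : Fin n → Bool) → 1 ≤ count p → ∃ λ i → p i ≡ true
count-some {suc n} p c with p zero in e
... | true  = zero , e
... | false with i , q ← count-some (p ∘ suc) c = suc i , q

count-two : ∀ {n} (p : Fin n → Bool) → count p ≤ 1 ⊎ ∃₂ λ i j → i ≢ j × p i ≡ true × p j ≡ true
count-two {zero}  p = inj₁ z≤n
count-two {suc n} p with p zero in e | count-two (p ∘ suc)
... | _     | inj₂ (i , j , ne , q , r) = inj₂ (suc i , suc j , (λ { refl → ne refl }) , q , r)
... | false | inj₁ c = inj₁ c
... | true  | inj₁ c with count (p ∘ suc) in e'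
...   | zero  = inj₁ (s≤s z≤n)
...   | suc _ with i , q ← count-some (p ∘ suc) (subst (1 ≤_) (sym e') (s≤s z≤n)) =
        inj₂ (zero , suc i , (λ ()) , e , q)

count-full : ∀ n → count {n} (λ _ → true) ≡ n
count-full zero    = refl
count-full (suc n) = cong suc (count-full n)

count-split : ∀ {n} (p c : Fin n → Bool) → count (λ v → p v ∧ c v) + count (λ v → p v ∧ not (c v)) ≡ count p
count-split {zero}  p c = refl
count-split {suc n} p c with p zero | c zero | count-split (p ∘ suc) (c ∘ suc)
... | false | _     | e = e
... | true  | true  | e = cong suc e
... | true  | false | e = trans (+-suc _ _) (cong suc e)

count-⊑ : ∀ {n} {p q : Fin n → Bool} → p ⊑ q → count q ≤ count p → q ⊑ p
count-⊑ {p = p} s c i e with p i in e'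
... | true  = refl
... | false = ⊥-elim (1+n≰n (≤-trans (count-< s i e' e) c))

sum : ∀ {n} → (Fin n → ℕ) → ℕ
sum {zero}  f = 0
sum {suc n} f = f zero + sum (f ∘ suc)

sum-mono : ∀ {n} {f g : Fin n → ℕ} → (∀ i → f i ≤ g i) → sum f ≤ sum g
sum-mono {zero}  p = z≤n
sum-mono {suc n} p = +-mono-≤ (p zero) (sum-mono (p ∘ suc))

sum-+ : ∀ {n} (f g : Fin n → ℕ) → sum (λ i → f i + g i) ≡ sum f + sum g
sum-+ {zero}  f g = refl
sum-+ {suc n} f g rewrite sum-+ (f ∘ suc) (g ∘ suc) = +-interchange (f zero) (g zero) _ _
  where
  +-interchange : ∀ a b c d → (a + b) + (c + d) ≡ (a + c) + (b + d)
  +-interchange a b c d = trans (+-assoc a b (c + d)) (trans (cong (a +_)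
    (trans (sym (+-assoc b c d)) (trans (cong (_+ d) (+-comm b c)) (+-assoc c b d)))) (sym (+-assoc a c (b + d))))

sum-≥ : ∀ {n} (f : Fin n → ℕ) i → f i ≤ sum f
sum-≥ {suc n} f zero    = m≤m+n _ _
sum-≥ {suc n} f (suc i) = ≤-trans (sum-≥ (f ∘ suc) i) (m≤n+m _ _)

sum-bit : ∀ {n} (p : Fin n → Bool) t → sum (λ i → bit (p i) * t) ≡ count p * t
sum-bit {zero}  p t = refl
sum-bit {suc n} p t rewrite sum-bit (p ∘ suc) t = sym (*-distribʳ-+ t (bit (p zero)) _)

union-bound : ∀ {k n} (I : Fin k → Bool) (F : Fin n → Fin k → Bool) →
  (∀ i → I i ≡ true → ∃ λ v → F v i ≡ true) → count I ≤ sum (λ v → count (F v))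
union-bound {zero}  I F c = z≤n
union-bound {suc k} I F c = subst (count I ≤_) (sym (sum-+ (λ v → bit (F v zero)) _))
  (+-mono-≤ head (union-bound (I ∘ suc) (λ v → F v ∘ suc) (c ∘ suc)))
  where
  head : bit (I zero) ≤ sum (λ v → bit (F v zero))
  head with I zero in e
  ... | false = z≤n
  ... | true with v , q ← c zero e = ≤-trans (≤-reflexive (cong bit (sym q))) (sum-≥ _ v)

fibre-bound : ∀ {k n} (I : Fin k → Bool) (B : Fin n → Bool) (F : Fin n → Fin k → Bool) t →
  (∀ i → I i ≡ true → ∃ λ v → B v ≡ true × F v i ≡ true) →
  (∀ v → B v ≡ true → count (F v) ≤ t) → count I ≤ count B * t
fibre-bound I B F t cov bnd = ≤-trans (union-bound I F' cov') (≤-trans (sum-mono each) (≤-reflexive (sum-bit B t)))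
  where
  F' : _ → _ → Bool
  F' v i = B v ∧ F v i
  cov' : ∀ i → I i ≡ true → ∃ λ v → F' v i ≡ true
  cov' i e with v , b , f ← cov i e = v , ∧-intro b f
  each : ∀ v → count (F' v) ≤ bit (B v) * t
  each v with B v in b
  ... | true  = ≤-trans (bnd v b) (≤-reflexive (sym (+-identityʳ t)))
  ... | false = ≤-reflexive (none (F v))
    where
    none : ∀ {k} (f : Fin k → Bool) → count (λ i → false ∧ f i) ≡ 0
    none {zero}  f = refl
    none {suc k} f = none (f ∘ suc)

-- The number of vertices of a position

module Bounds (D : Digraph) where
  open Position D public

  blues reds : Pos → ℕ
  blues S = count (λ v → S v ∧ blue D v)
  reds  S = count (λ v → S v ∧ not (blue D v))

  private
    restrict : ∀ {S T : Pos} (c : Pos) → S ⊑ T → (λ v → S v ∧ c v) ⊑ (λ v → T v ∧ c v)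
    restrict c s i e with p , q ← ∧-true e = ∧-intro (s i p) q

  blues-mono : ∀ S T → S ⊑ T → blues S ≤ blues T
  blues-mono S T s = count-mono (restrict (blue D) s)

  reds-mono : ∀ S T → S ⊑ T → reds S ≤ reds T
  reds-mono S T s = count-mono (restrict (not ∘ blue D) s)

  blues-∖-< : ∀ S v → S v ≡ true → blue D v ≡ true → blues (S ∖ v) < blues S
  blues-∖-< S v s b = count-< (restrict (blue D) (delete-⊑ D v S)) v
    (subst (λ x → x ∧ blue D v ≡ false) (sym (delete-self D v S)) refl) (∧-intro s b)

  reds-∖-< : ∀ S v → S v ≡ true → blue D v ≡ false → reds (S ∖ v) < reds S
  reds-∖-< S v s b = count-< (restrict (not ∘ blue D) (delete-⊑ D v S)) v
    (subst (λ x → x ∧ not (blue D v) ≡ false) (sym (delete-self D v S)) refl) (∧-intro s (cong not b))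

  -- If no red vertex is lost, the move only takes blue vertices away, which cannot help Left.
  ∖-≼ : ∀ S v → reds S ≤ reds (S ∖ v) → ⟦ S ∖ v ⟧ ≼ ⟦ S ⟧
  ∖-≼ S v c = mono (S ∖ v) S (λ u _ → delete-⊑ D v S u)
    λ u b s → proj₁ (∧-true (count-⊑ (restrict (not ∘ blue D) (delete-⊑ D v S)) c u (∧-intro s (cong not b))))

  ≼-∖ : ∀ S v → blues S ≤ blues (S ∖ v) → ⟦ S ⟧ ≼ ⟦ S ∖ v ⟧
  ≼-∖ S v c = mono S (S ∖ v)
    (λ u b s → proj₁ (∧-true (count-⊑ (restrict (blue D) (delete-⊑ D v S)) c u (∧-intro s b))))
    λ u _ → delete-⊑ D v S u

  -- Each move of Right uses up a red vertex, so Right never makes more than `r` moves, however Left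
  -- plays.
  neg-reds : ∀ r S → reds S ≤ r → neg[ r ] ≼ ⟦ S ⟧
  neg-reds r S c = ≽-intro-⟦⟧ {neg[ r ]} {S} (answer r c) (none r)
    where
    none : ∀ r i → leftOption neg[ r ] i ⊲ ⟦ S ⟧
    none zero ()
    none (suc r) ()
    answer : ∀ r → reds S ≤ r → ∀ v → S v ≡ true → blue D v ≡ false → neg[ r ] ⊲ ⟦ S ∖ v ⟧
    answer r c v s b with ≤-trans (reds-∖-< S v s b) c
    answer (suc r) c v s b | s≤s c' = ⊲-byRight neg[ suc r ] _ zero (neg-reds r (S ∖ v) c')

  pos-blues : ∀ r S → blues S ≤ r → ⟦ S ⟧ ≼ pos r
  pos-blues r S c = ≼-intro-⟦⟧ {pos r} {S} (answer r c) (none r)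
    where
    none : ∀ r i → ⟦ S ⟧ ⊲ rightOption (pos r) i
    none zero ()
    none (suc r) ()
    answer : ∀ r → blues S ≤ r → ∀ v → S v ≡ true → blue D v ≡ true → ⟦ S ∖ v ⟧ ⊲ pos r
    answer r c v s b with ≤-trans (blues-∖-< S v s b) c
    answer (suc r) c v s b | s≤s c' = ⊲-byLeft _ (pos (suc r)) zero (pos-blues r (S ∖ v) c')

  reds-> : ∀ r S → ⟦ S ⟧ ⊲ neg[ r ] → r < reds S
  reds-> r S p = ≰⇒> λ c → ≼⇒¬⊲ _ _ (neg-reds r S c) p

  blues-> : ∀ r S → pos r ⊲ ⟦ S ⟧ → r < blues S
  blues-> r S p = ≰⇒> λ c → ≼⇒¬⊲ _ _ (pos-blues r S c) p

  blues+reds : ∀ S → blues S + reds S ≤ size D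
  blues+reds S = ≤-trans (≤-reflexive (count-split S (blue D))) (count-≤ S)

-- Reversible moves in positions with few vertices

switch : ∀ {k} → (Fin k → Game) → ℕ → Game
switch {k} a N = mk k a 1 (λ _ → neg[ N ])

-- By `low` and `lowʳ`, neither `a i` nor a Right option of it lies below `X`, whose Right option is
-- `-3`. By `threat`, `a i` has a Left option that is not at most 1 and that Right cannot reverse,
-- which forces blue vertices on any position equal to `a i`.
module Reversal (D : Digraph) {k : ℕ} (a : Fin k → Game)
  (antichain : ∀ i j → a i ≼ a j → i ≡ j)
  (low : ∀ i → neg[ 3 ] ≼ a i)
  (lowʳ : ∀ i j → neg[ 3 ] ≼ rightOption (a i) j)
  (threat : ∀ i → ∃ λ l → pos 1 ⊲ leftOption (a i) l × (∀ r → a i ⊲ rightOption (leftOption (a i) l) r))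
  where
  open Bounds D

  X : Game
  X = switch a 3

  serves : Fin k → Pos → Set
  serves i Z = a i ⊲ ⟦ Z ⟧

  private
    a⋠X : ∀ i → ¬ (a i ≼ X)
    a⋠X i p = ≼⇒¬⊲ _ _ (low i) (≼-right (a i) X p zero)

  reds-≥4 : ∀ Z → ⟦ Z ⟧ ≼ X → 4 ≤ reds Z
  reds-≥4 Z z = reds-> 3 Z (≼-right _ X z zero)

  -- The alternative would be a Right option of `a i` below `⟦ Z ⟧`, hence below `X`. This is
  -- impossible by `lowʳ`.
  serving-vertex : ∀ Z → ⟦ Z ⟧ ≼ X → ∀ i → serves i Z →
    ∃ λ v → Z v ≡ true × blue D v ≡ true × a i ≼ ⟦ Z ∖ v ⟧
  serving-vertex Z z i p with ⊲-elimBlue {a i} {Z} p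
  ... | inj₂ q = q
  ... | inj₁ (j , q) = ⊥-elim (≼⇒¬⊲ (rightOption (a i) j) X (≼-trans _ _ _ q z)
          (⊲-byRight X _ zero (lowʳ i j)))

  -- `Y` stands for what remains of `Z` after Left's move at `v` and Right's reversing reply;
  -- whatever `v` served is still served there.
  record Reversed (Z : Pos) (v : Fin (size D)) : Set where
    field
      Y       : Pos
      Y≼X     : ⟦ Y ⟧ ≼ X
      blues-Y : 2 + blues Y ≤ blues Z
      reds-Y  : 2 + reds Y ≤ reds Z
      keeps   : ∀ i → a i ≼ ⟦ Z ∖ v ⟧ → serves i Y

  -- As `⟦ Z ∖ v ⟧ ⊲ X`, either the position lies below a Left option of `X` or Right has a reply
  -- `w` back below `X`. In the second case `v` must delete a red vertex and `w` a blue one, since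
  -- otherwise monotonicity would give `a i ≼ X`. Together with `v` and `w` themselves this costs
  -- two vertices of each colour.
  exact-or-reversed : ∀ Z → ⟦ Z ⟧ ≼ X → ∀ i v → Z v ≡ true → blue D v ≡ true → a i ≼ ⟦ Z ∖ v ⟧ →
    (∃ λ j → ⟦ Z ∖ v ⟧ ≼ a j) ⊎ Reversed Z v
  exact-or-reversed Z z i v s b p with ⊲-elimRed {X} {Z ∖ v} (≼-move {X} {Z} z v s b)
  ... | inj₁ q = inj₁ q
  ... | inj₂ (w , s' , b' , q) = inj₂ record
    { Y = Z ∖ v ∖ w
    ; Y≼X = q
    ; blues-Y = ≤-trans (s≤s kills-blue) (blues-∖-< Z v s b)
    ; reds-Y = ≤-trans (s≤s (reds-∖-< (Z ∖ v) w s' b')) kills-red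
    ; keeps = λ i' p' → ≽-move {a i'} {Z ∖ v} p' w s' b'
    }
    where
    kills-red : suc (reds (Z ∖ v)) ≤ reds Z
    kills-red = ≰⇒> λ c → a⋠X i (≼-trans _ _ _ p (≼-trans _ _ _ (∖-≼ Z v c) z))
    kills-blue : suc (blues (Z ∖ v ∖ w)) ≤ blues (Z ∖ v)
    kills-blue = ≰⇒> λ c → a⋠X i (≼-trans _ _ _ p (≼-trans _ _ _ (≼-∖ (Z ∖ v) w c) q))

  private
    -- The threatening Left option of `a i` must be met by a blue vertex `v`. What remains after `v`
    -- is not at most 1 and so has at least two blue vertices.
    blues-exact : ∀ i S → a i ≼ ⟦ S ⟧ → ⟦ S ⟧ ≼ a i → 3 ≤ blues S
    blues-exact i S p q with l , t , h ← threat i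
      with ⊲-elimBlue {leftOption (a i) l} {S} (≼-left (a i) _ p l)
    ... | inj₁ (r , c) = ⊥-elim (≼⇒¬⊲ _ _ (≼-trans _ _ _ c q) (h r))
    ... | inj₂ (v , s , b , c) = ≤-trans (s≤s (blues-> 1 (S ∖ v) (⊲-≼-trans _ _ _ t c))) (blues-∖-< S v s b)

  -- Induction on a bound `n` for the blue vertices. If the serving move is exact, the antichain
  -- condition makes the position after it equal to `a i`, with three blue vertices besides `v`;
  -- otherwise `Y` still serves `i` and is smaller.
  blues-≥4 : ∀ n Z → blues Z ≤ n → ⟦ Z ⟧ ≼ X → ∀ i → serves i Z → 4 ≤ blues Z
  blues-≥4 n Z c z i p with v , s , b , q ← serving-vertex Z z i p = go n c (exact-or-reversed Z z i v s b q)
    where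
    go : ∀ n → blues Z ≤ n → (∃ λ j → ⟦ Z ∖ v ⟧ ≼ a j) ⊎ Reversed Z v → 4 ≤ blues Z
    go n c (inj₁ (j , r)) with refl ← antichain i j (≼-trans _ _ _ q r) =
      ≤-trans (s≤s (blues-exact i (Z ∖ v) q r)) (blues-∖-< Z v s b)
    go zero c (inj₂ R) with ≤-trans (Reversed.blues-Y R) c
    ... | ()
    go (suc n) c (inj₂ R) =
      ≤-trans (blues-≥4 n Y (≤-pred (≤-trans (n≤1+n _) (≤-trans blues-Y c))) Y≼X i (keeps i q))
              (≤-trans (m≤n+m _ 2) blues-Y)
      where open Reversed R

  private
    group : Pos → Fin (size D) → Fin k → Bool
    group Z v i = leb (a i) ⟦ Z ∖ v ⟧

    cover : ∀ Z → ⟦ Z ⟧ ≼ X → ∀ (I : Fin k → Bool) → (∀ i → I i ≡ true → serves i Z) →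
      ∀ i → I i ≡ true → ∃ λ v → Z v ∧ blue D v ≡ true × group Z v i ≡ true
    cover Z z I srv i e with v , s , b , p ← serving-vertex Z z i (srv i e) = v , ∧-intro s b , ≼⇒leb _ _ p

    -- Two members `i` and `j` of a group with `⟦ Z ∖ v ⟧ ≼ a l` would both equal `l` by the
    -- antichain condition, so a group with two members forces a reversal.
    large-group : ∀ Z → ⟦ Z ⟧ ≼ X → ∀ v → Z v ≡ true → blue D v ≡ true →
      count (group Z v) ≤ 1 ⊎ (∃ λ i → a i ≼ ⟦ Z ∖ v ⟧) × Reversed Z v
    large-group Z z v s b with count-two (group Z v)
    ... | inj₁ c = inj₁ c
    ... | inj₂ (i , j , ne , p , q) with exact-or-reversed Z z i v s b (leb-true _ _ p)
    ...   | inj₂ R = inj₂ ((i , leb-true _ _ p) , R)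
    ...   | inj₁ (l , r) = ⊥-elim (ne (trans (antichain i l (≼-trans _ _ _ (leb-true _ _ p) r))
                                   (sym (antichain j l (≼-trans _ _ _ (leb-true _ _ q) r)))))

    two-more : ∀ {x y} → 4 ≤ x → 2 + x ≤ y → 6 ≤ y
    two-more p q = ≤-trans (+-monoʳ-≤ 2 p) q

  -- A reversal leaves a `Y` with four vertices of each colour, so `Z` would have six of each. Hence
  -- each blue vertex serves at most one element.
  served-0 : ∀ Z → ⟦ Z ⟧ ≼ X → ¬ (6 ≤ blues Z × 6 ≤ reds Z) →
    ∀ (I : Fin k → Bool) → (∀ i → I i ≡ true → serves i Z) → count I ≤ blues Z
  served-0 Z z small I srv = ≤-trans
    (fibre-bound I (λ v → Z v ∧ blue D v) (group Z) 1 (cover Z z I srv) each) (≤-reflexive (*-identityʳ _))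
    where
    each : ∀ v → Z v ∧ blue D v ≡ true → count (group Z v) ≤ 1
    each v e with s , b ← ∧-true e with large-group Z z v s b
    ... | inj₁ c = c
    ... | inj₂ ((i , p) , R) = ⊥-elim (small
      ( two-more (blues-≥4 _ Y ≤-refl Y≼X i (keeps i p)) blues-Y
      , two-more (reds-≥4 Y Y≼X) reds-Y))
      where open Reversed R

  -- A reversal may happen once, but then `Y` has too few vertices for another one. By `served-0` a
  -- group is bounded by the blue vertices of `Y`, which number at most `blues Z ∸ 2`.
  served-1 : ∀ Z → ⟦ Z ⟧ ≼ X → ¬ (8 ≤ blues Z × 8 ≤ reds Z) →
    ∀ (I : Fin k → Bool) → (∀ i → I i ≡ true → serves i Z) → count I ≤ blues Z * (1 ⊔ (blues Z ∸ 2))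
  served-1 Z z small I srv =
    fibre-bound I (λ v → Z v ∧ blue D v) (group Z) (1 ⊔ (blues Z ∸ 2)) (cover Z z I srv) each
    where
    each : ∀ v → Z v ∧ blue D v ≡ true → count (group Z v) ≤ 1 ⊔ (blues Z ∸ 2)
    each v e with s , b ← ∧-true e with large-group Z z v s b
    ... | inj₁ c = ≤-trans c (m≤m⊔n 1 (blues Z ∸ 2))
    ... | inj₂ (_ , R) = ≤-trans
      (served-0 Y Y≼X
        (λ { (p , q) → small (≤-trans (+-monoʳ-≤ 2 p) blues-Y , ≤-trans (+-monoʳ-≤ 2 q) reds-Y) })
        (group Z v) (λ i g → keeps i (leb-true _ _ g)))
      (≤-trans (∸-monoˡ-≤ 2 blues-Y) (m≤n⊔m 1 (blues Z ∸ 2)))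
      where open Reversed R

  few-options : size D ≤ 15 → digraphGame D ≋ X → k ≤ 63
  few-options n≤15 (p , q) = subst (_≤ 63) (count-full k) bound
    where
    Z : Pos
    Z = λ _ → true
    srv : ∀ i → true ≡ true → serves i Z
    srv i _ = ⊲-≼-trans _ X _ (⊲-byLeft (a i) X i (≼-refl (a i))) q
    total : blues Z + reds Z ≤ 15
    total = ≤-trans (blues+reds Z) n≤15
    bound : count {k} (λ _ → true) ≤ 63
    -- With at most nine blue vertices the bound is `9 * 7 = 63`, and 15 vertices cannot contain
    -- eight of each colour. Ten blue vertices leave at most five red ones, and then no reversal is
    -- possible at all.
    bound with ≤-<-connex (blues Z) 9
    ... | inj₁ b≤9 = ≤-trans
      (served-1 Z p (λ { (x , y) → 1+n≰n (≤-trans (+-mono-≤ x y) total) }) (λ _ → true) srv)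
      (*-mono-≤ b≤9 (⊔-lub (s≤s z≤n) (∸-monoˡ-≤ 2 b≤9)))
    ... | inj₂ 9<b = ≤-trans
      (served-0 Z p (λ { (_ , y) → 1+n≰n (≤-trans (+-mono-≤ 9<b y) total) }) (λ _ → true) srv)
      (≤-trans (m≤m+n _ _) (≤-trans total (m≤m+n 15 48)))

fromLists-left : ∀ ls rs {x} → x ∈ ls → ∃ λ i → leftOption (fromLists ls rs) i ≡ x
fromLists-left ls rs p = index p , sym (lookup-index p)

fromLists-right : ∀ ls rs {x} → x ∈ rs → ∃ λ i → rightOption (fromLists ls rs) i ≡ x
fromLists-right ls rs p = index p , sym (lookup-index p)

-- Probing a game

-- The probe (true , r) asks whether r ⊲ G, and (false , r) whether r ≼ G.
Probe : Set
Probe = Bool × Game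

holds : Game → Probe → Bool
holds G (true  , r) = not (leb G r)
holds G (false , r) = leb r G

implies : Probe → Probe → Bool
implies (true  , r) (true  , s) = leb s r
implies (false , r) (false , s) = leb s r
implies (false , r) (true  , s) = not (leb r s)
implies (true  , r) (false , s) = false

⊲⇒holds : ∀ G r → r ⊲ G → holds G (true , r) ≡ true
⊲⇒holds G r p = cong not (⊲⇒leb G r p)

holds⇒⊲ : ∀ G r → holds G (true , r) ≡ true → r ⊲ G
holds⇒⊲ G r e with leb G r in e'
... | false = leb-false G r e'

implies-sound : ∀ G u v → implies u v ≡ true → holds G u ≡ true → holds G v ≡ true
implies-sound G (true  , r) (true  , s) e h = ⊲⇒holds G s (≼-⊲-trans s r G (leb-true s r e) (holds⇒⊲ G r h))
implies-sound G (false , r) (false , s) e h = ≼⇒leb s G (≼-trans s r G (leb-true s r e) (leb-true r G h))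
implies-sound G (false , r) (true  , s) e h = ⊲⇒holds G s (⊲-≼-trans s r G (holds⇒⊲ r s e) (leb-true r G h))

okTrue okFalse : List Bool → List Bool → Bool
okTrue (f ∷ fs) (b ∷ bs) = (not f ∨ b) ∧ okTrue fs bs
okTrue _ _ = true
okFalse (f ∷ fs) (b ∷ bs) = not (f ∧ b) ∧ okFalse fs bs
okFalse _ _ = true

-- For each probe, its implications to and from the earlier ones, tabulated before the search.
rows : List Probe → List Probe → List (List Bool × List Bool)
rows prev [] = []
rows prev (v ∷ vs) = (map (implies v) prev , map (λ u → implies u v) prev) ∷ rows (v ∷ prev) vs

-- Enumerates the vectors of answers that respect the tabulated implications. The newest answer is
-- at the head, so the vectors belong to the reversed list of probes.
solve : List (List Bool × List Bool) → List Bool → List (List Bool)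
solve [] bs = bs ∷ []
solve ((f , g) ∷ rs) bs =
  (if okFalse g bs then solve rs (false ∷ bs) else []) ++ (if okTrue f bs then solve rs (true ∷ bs) else [])

private
  okTrue-holds : ∀ G v us → holds G v ≡ true → okTrue (map (implies v) us) (map (holds G) us) ≡ true
  okTrue-holds G v [] h = refl
  okTrue-holds G v (u ∷ us) h with implies v u in e
  ... | false = okTrue-holds G v us h
  ... | true rewrite implies-sound G v u e h = okTrue-holds G v us h

  okFalse-holds : ∀ G v us → holds G v ≡ false → okFalse (map (λ u → implies u v) us) (map (holds G) us) ≡ true
  okFalse-holds G v [] h = refl
  okFalse-holds G v (u ∷ us) h with implies u v in e | holds G u in e'
  ... | false | _     = okFalse-holds G v us h
  ... | true  | false = okFalse-holds G v us h
  ... | true  | true with trans (sym h) (implies-sound G u v e e')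
  ... | ()

-- The answers of an actual game respect all implications, so its branch is never pruned.
solve-complete : ∀ G prev vs → map (holds G) (vs ʳ++ prev) ∈ solve (rows prev vs) (map (holds G) prev)
solve-complete G prev [] = here refl
solve-complete G prev (v ∷ vs) with holds G v in e | solve-complete G (v ∷ prev) vs
... | false | p rewrite okFalse-holds G v prev e = ∈-++⁺ˡ p
... | true  | p rewrite okTrue-holds G v prev e = ∈-++⁺ʳ _ p

-- A positive answer to `r ⊲ G` makes `r` a Left option. A negative answer to `r ≼ G` means `G ⊲ r`
-- and makes it a Right option.
lefts rights : List Probe → List Bool → List Game
lefts ((true  , r) ∷ us) (true ∷ bs) = r ∷ lefts us bs
lefts (_ ∷ us) (_ ∷ bs) = lefts us bs
lefts _ _ = []
rights ((false , r) ∷ us) (false ∷ bs) = r ∷ rights us bs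
rights (_ ∷ us) (_ ∷ bs) = rights us bs
rights _ _ = []

gameOf : List Probe → List Bool → Game
gameOf us bs = fromLists (lefts us bs) (rights us bs)

private
  lefts⁻ : ∀ G us {x} → x ∈ lefts us (map (holds G) us) → x ⊲ G
  lefts⁻ G ((true , r) ∷ us) p with leb G r in e
  lefts⁻ G ((true , r) ∷ us) (here refl) | false = leb-false G r e
  lefts⁻ G ((true , r) ∷ us) (there p)   | false = lefts⁻ G us p
  ... | true = lefts⁻ G us p
  lefts⁻ G ((false , r) ∷ us) p with leb r G
  ... | true  = lefts⁻ G us p
  ... | false = lefts⁻ G us p

  rights⁻ : ∀ G us {x} → x ∈ rights us (map (holds G) us) → G ⊲ x
  rights⁻ G ((false , r) ∷ us) p with leb r G in e
  rights⁻ G ((false , r) ∷ us) (here refl) | false = leb-false r G e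
  rights⁻ G ((false , r) ∷ us) (there p)   | false = rights⁻ G us p
  ... | true = rights⁻ G us p
  rights⁻ G ((true , r) ∷ us) p with leb G r
  ... | true  = rights⁻ G us p
  ... | false = rights⁻ G us p

  lefts⁺ : ∀ G us {x} → (true , x) ∈ us → x ⊲ G → x ∈ lefts us (map (holds G) us)
  lefts⁺ G ((true , r) ∷ us) (here refl) q rewrite ⊲⇒leb G r q = here refl
  lefts⁺ G ((true , r) ∷ us) (there p) q with leb G r
  ... | true  = lefts⁺ G us p q
  ... | false = there (lefts⁺ G us p q)
  lefts⁺ G ((false , r) ∷ us) (there p) q with leb r G
  ... | true  = lefts⁺ G us p q
  ... | false = lefts⁺ G us p q

  rights⁺ : ∀ G us {x} → (false , x) ∈ us → G ⊲ x → x ∈ rights us (map (holds G) us)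
  rights⁺ G ((false , r) ∷ us) (here refl) q rewrite ⊲⇒leb r G q = here refl
  rights⁺ G ((false , r) ∷ us) (there p) q with leb r G
  ... | true  = rights⁺ G us p q
  ... | false = there (rights⁺ G us p q)
  rights⁺ G ((true , r) ∷ us) (there p) q with leb G r
  ... | true  = rights⁺ G us p q
  ... | false = rights⁺ G us p q

-- Lists of all games born by a given day

Covers : ℕ → List Game → Set
Covers b rs = ∀ G → Born b G → ∃ λ r → r ∈ rs × G ≋ r

-- Every option of `G` equals a game in `rs`, which occurs among the new options. The remaining new
-- options are gift horses: Left options `r ⊲ G` and Right options `r` with `G ⊲ r` do not change
-- the value.
gameOf-≋ : ∀ b rs us → Covers b rs → (∀ {r} c → r ∈ rs → (c , r) ∈ us) →
  ∀ G → Born (suc b) G → G ≋ gameOf us (map (holds G) us)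
gameOf-≋ b rs us cov mem G born =
  ≼-intro G H
    (λ i → let r , p , q , _ = cov _ (Born-left b G born i)
               r⊲G = ≼⊲ (proj₂ (proj₂ (proj₂ (cov _ (Born-left b G born i))))) (⊲-byLeft _ G i (≼-refl (leftOption G i)))
               j , e = fromLists-left ls rs′ (lefts⁺ G us (mem true p) r⊲G)
           in ⊲-byLeft _ H j (subst (leftOption G i ≼_) (sym e) q))
    (λ j → rights⁻ G us (∈-lookup {xs = rs′} j)) ,
  ≼-intro H G
    (λ i → lefts⁻ G us (∈-lookup {xs = ls} i))
    (λ j → let r , p , q , q' = cov _ (Born-right b G born j)
               G⊲r = ⊲-≼-trans G _ r (⊲-byRight G _ j (≼-refl (rightOption G j))) q
               i , e = fromLists-right ls rs′ (rights⁺ G us (mem false p) G⊲r)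
           in ⊲-byRight H _ i (subst (_≼ rightOption G j) (sym e) q'))
  where
  H = gameOf us (map (holds G) us)
  ls = lefts us (map (holds G) us)
  rs′ = rights us (map (holds G) us)
  ≼⊲ : ∀ {A B C} → A ≼ B → B ⊲ C → A ⊲ C
  ≼⊲ = ≼-⊲-trans _ _ _

-- The order of the probes only affects the number of chains found below.
probes : List Game → List Probe
probes rs = map (false ,_) rs ++ (map (true ,_) rs ʳ++ [])

reversedProbes : List Game → List Probe
reversedProbes rs = probes rs ʳ++ []

codes : List Game → List (List Bool)
codes rs = solve (rows [] (probes rs)) []

nextCover : List Game → List Game
nextCover rs = map (gameOf (reversedProbes rs)) (codes rs)

private
  ∈-ʳ++ : ∀ {A : Set} (xs : List A) {ys x} → x ∈ xs ⊎ x ∈ ys → x ∈ xs ʳ++ ys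
  ∈-ʳ++ [] (inj₂ p) = p
  ∈-ʳ++ (x ∷ xs) (inj₁ (here p))  = ∈-ʳ++ xs (inj₂ (here p))
  ∈-ʳ++ (x ∷ xs) (inj₁ (there p)) = ∈-ʳ++ xs (inj₁ p)
  ∈-ʳ++ (x ∷ xs) (inj₂ p) = ∈-ʳ++ xs (inj₂ (there p))

∈-probes : ∀ rs {r} c → r ∈ rs → (c , r) ∈ reversedProbes rs
∈-probes rs false p = ∈-ʳ++ (probes rs) (inj₁ (∈-++⁺ˡ (∈-map⁺ _ p)))
∈-probes rs true  p = ∈-ʳ++ (probes rs) (inj₁ (∈-++⁺ʳ (map (false ,_) rs) (∈-ʳ++ (map (true ,_) rs) (inj₁ (∈-map⁺ _ p)))))

codeOf : List Game → Game → List Bool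
codeOf rs G = map (holds G) (reversedProbes rs)

codeOf-∈ : ∀ rs G → codeOf rs G ∈ codes rs
codeOf-∈ rs G = solve-complete G [] (probes rs)

nextCover-covers : ∀ b rs → Covers b rs → Covers (suc b) (nextCover rs)
nextCover-covers b rs cov G born =
  gameOf us (codeOf rs G) , ∈-map⁺ (gameOf us) (codeOf-∈ rs G) , gameOf-≋ b rs us cov (∈-probes rs) G born
  where us = reversedProbes rs

cover : ℕ → List Game
cover zero    = 0ᵍ ∷ []
cover (suc b) = nextCover (cover b)

cover-covers : ∀ b → Covers b (cover b)
cover-covers zero (mk m L n R) (refl , refl) = 0ᵍ , here refl , ((λ ()) , (λ ())) , ((λ ()) , (λ ()))
cover-covers (suc b) = nextCover-covers b (cover b) (cover-covers b)

-- Players are Booleans: true is Left, false is Right.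

optionSize : Bool → Game → ℕ
optionSize true  = leftSize
optionSize false = rightSize

option : ∀ c G → Fin (optionSize c G) → Game
option true  = leftOption
option false = rightOption

infix 4 _≼[_]_ _⊲[_]_

_≼[_]_ _⊲[_]_ : Game → Bool → Game → Set
G ≼[ true ]  H = G ≼ H
G ≼[ false ] H = H ≼ G
G ⊲[ true ]  H = G ⊲ H
G ⊲[ false ] H = H ⊲ G

≼[]-refl : ∀ c G → G ≼[ c ] G
≼[]-refl true  = ≼-refl
≼[]-refl false = ≼-refl

≼[]-trans : ∀ c {G H K} → G ≼[ c ] H → H ≼[ c ] K → G ≼[ c ] K
≼[]-trans true  p q = ≼-trans _ _ _ p q
≼[]-trans false p q = ≼-trans _ _ _ q p

≼-⊲[]-trans : ∀ c {G H K} → G ≼[ c ] H → H ⊲[ c ] K → G ⊲[ c ] K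
≼-⊲[]-trans true  p q = ≼-⊲-trans _ _ _ p q
≼-⊲[]-trans false p q = ⊲-≼-trans _ _ _ q p

⊲-≼[]-trans : ∀ c {G H K} → G ⊲[ c ] H → H ≼[ c ] K → G ⊲[ c ] K
⊲-≼[]-trans true  p q = ⊲-≼-trans _ _ _ p q
⊲-≼[]-trans false p q = ≼-⊲-trans _ _ _ q p

≋⇒≼[] : ∀ c {G H} → G ≋ H → G ≼[ c ] H
≋⇒≼[] true  = proj₁
≋⇒≼[] false = proj₂

⊲[]-option : ∀ c G i → option c G i ⊲[ c ] G
⊲[]-option true  G i = ⊲-byLeft _ G i (≼-refl (leftOption G i))
⊲[]-option false G i = ⊲-byRight G _ i (≼-refl (rightOption G i))

integer : Bool → ℕ → Game
integer true  = pos
integer false = neg[_]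

Born⇒≼[] : ∀ c b G → Born b G → G ≼[ c ] integer c b
Born⇒≼[] true  = Born⇒≼
Born⇒≼[] false = Born⇒≽

-- Digraphs on an arbitrary finite set of vertices

module Build {V : Set} {n : ℕ} (iso : Fin n ↔ V) (colour : V → Bool) (keeps : V → V → Bool)
  (irreflexive : ∀ v → keeps v v ≡ false) where

  open Inverse iso

  D : Digraph
  D = record { size = n ; blue = colour ∘ to ; arc = λ i j → not (keeps (to i) (to j)) }

  private module P = Position D

  ⟪_⟫ : (V → Bool) → Game
  ⟪ S ⟫ = P.⟦ S ∘ to ⟧

  infixl 6 _-_
  _-_ : (V → Bool) → V → (V → Bool)
  (S - v) w = S w ∧ keeps v w

  -- `keeps v w` says that `w` survives a move at `v`; irreflexivity accounts for the deletion of
  -- the chosen vertex itself.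
  delete-keeps : ∀ T i j → delete D i T j ≡ T j ∧ keeps (to i) (to j)
  delete-keeps T i j with j Fin.≟ i
  ... | yes refl rewrite irreflexive (to i) = refl
  ... | no _ with keeps (to i) (to j)
  ...   | true  = refl
  ...   | false = refl

  private
    delete-≋ : ∀ S i → P.⟦ delete D i (S ∘ to) ⟧ ≋ ⟪ S - to i ⟫
    delete-≋ S i = P.⟦⟧-cong _ _ (delete-keeps (S ∘ to) i) , P.⟦⟧-cong _ _ (λ j → sym (delete-keeps (S ∘ to) i j))

    delete-from : ∀ S v → P.⟦ delete D (from v) (S ∘ to) ⟧ ≋ ⟪ S - v ⟫
    delete-from S v = subst (λ u → P.⟦ delete D (from v) (S ∘ to) ⟧ ≋ ⟪ S - u ⟫) (strictlyInverseˡ v) (delete-≋ S (from v))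

  move : ∀ c H S v → S v ≡ true → colour v ≡ c → H ≼[ c ] ⟪ S - v ⟫ → H ⊲[ c ] ⟪ S ⟫
  move true H S v s b p = P.⊲-byBlue {H} {S ∘ to} (from v)
    (trans (cong S (strictlyInverseˡ v)) s) (trans (cong colour (strictlyInverseˡ v)) b)
    (≼-trans H _ _ p (proj₂ (delete-from S v)))
  move false H S v s b p = P.⊲-byRed {H} {S ∘ to} (from v)
    (trans (cong S (strictlyInverseˡ v)) s) (trans (cong colour (strictlyInverseˡ v)) b)
    (≼-trans _ _ H (proj₁ (delete-from S v)) p)

  defend : ∀ c H S → (∀ v → S v ≡ true → colour v ≡ not c → H ⊲[ c ] ⟪ S - v ⟫) →
    (∀ i → option c H i ⊲[ c ] ⟪ S ⟫) → H ≼[ c ] ⟪ S ⟫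
  defend true  H S p q = P.≽-intro-⟦⟧ {H} {S ∘ to}
    (λ i s b → ⊲-≼-trans H _ _ (p (to i) s b) (proj₂ (delete-≋ S i))) q
  defend false H S p q = P.≼-intro-⟦⟧ {H} {S ∘ to}
    (λ i s b → ≼-⊲-trans _ _ H (proj₁ (delete-≋ S i)) (p (to i) s b)) q

total : ∀ {W} → (Fin W → ℕ) → ℕ
total {zero}  f = 0
total {suc W} f = f zero + total (f ∘ suc)

Σ-iso : ∀ {W} (f : Fin W → ℕ) → Fin (total f) ↔ Σ (Fin W) (Fin ∘ f)
Σ-iso {zero} f = mk↔ₛ′ (λ ()) (λ { (() , _) }) (λ { (() , _) }) (λ ())
Σ-iso {suc W} f = (mk↔ₛ′ to from
    (λ { (zero , x) → refl ; (suc s , x) → refl }) (λ { (inj₁ x) → refl ; (inj₂ (s , x)) → refl }))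
    ↔-∘ ((↔-id _ ⊎-↔ Σ-iso (f ∘ suc)) ↔-∘ +↔⊎)
  where
  to : Fin (f zero) ⊎ Σ (Fin W) (Fin ∘ f ∘ suc) → Σ (Fin (suc W)) (Fin ∘ f)
  to (inj₁ x) = zero , x
  to (inj₂ (s , x)) = suc s , x
  from : Σ (Fin (suc W)) (Fin ∘ f) → Fin (f zero) ⊎ Σ (Fin W) (Fin ∘ f ∘ suc)
  from (zero , x) = inj₁ x
  from (suc s , x) = inj₂ (s , x)

-- A vertex of a private digraph, of the gadget or of an empty slot is useless as
-- an initial move, since the opponent has a reply to a large integer: such a
-- vertex keeps a group of the gadget in the other colour which deletes all that
-- the first player has left.
module Slots {W : ℕ} (owner : Fin W → Bool) (filled : Fin W → Bool) (digraph : Fin W → Digraph) (t : ℕ) where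

  -- Each slot has a vertex `top s` for the move into it and a private digraph `base s`. The gadget
  -- has, for each colour `c`, two groups `g` of `t + 1` vertices.
  V : Set
  V = Fin W ⊎ Σ (Fin W) (Fin ∘ size ∘ digraph) ⊎ (Bool × Bool × Fin (suc t))

  pattern top s      = inj₁ s
  pattern base s x   = inj₂ (inj₁ (s , x))
  pattern gad c g k  = inj₂ (inj₂ (c , g , k))

  colour : V → Bool
  colour (top s)     = owner s
  colour (base s x)  = blue (digraph s) x
  colour (gad c g k) = c

  same : Bool → Bool → Bool
  same true  b = b
  same false b = not b

  -- The part of the gadget that survives a useless move by player `c`: the group `true` of the
  -- opponent.
  neutral : Bool → V → Bool
  neutral c (gad c' true k) = same (not c) c'
  neutral c _ = false

  -- The group of the other colour that survives a move in group `g` of colour `c`. Applied for both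
  -- colours in turn it gives `not g`, so a reply in the surviving group deletes what the first move
  -- left of its own group.
  rival : Bool → Bool → Bool
  rival true  g = not g
  rival false g = g

  keepsBase : ∀ s → Fin (size (digraph s)) → ∀ s' → Fin (size (digraph s')) → Bool
  keepsBase s x s' y with s Fin.≟ s'
  ... | yes refl = not (does (y Fin.≟ x) ∨ arc (digraph s) x y)
  ... | no _     = false

  keeps : V → V → Bool
  keeps (top s) w with filled s
  keeps (top s) (base s' x) | true = does (s Fin.≟ s')
  keeps (top s) _           | true = false
  keeps (top s) w           | false = neutral (owner s) w
  keeps (base s x) (base s' y) = keepsBase s x s' y
  keeps (base s x) w = neutral (blue (digraph s) x) w
  keeps (gad c g k) (gad c' g' k') =
    if same c c' then same g g' ∧ not (does (k Fin.≟ k')) else same g' (rival c g)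
  keeps (gad c g k) _ = false

  private
    same-refl : ∀ b → same b b ≡ true
    same-refl true  = refl
    same-refl false = refl

    same-true : ∀ a b → same a b ≡ true → a ≡ b
    same-true true  true  _ = refl
    same-true false false _ = refl

    irreflexive : ∀ v → keeps v v ≡ false
    irreflexive (top s) with filled s
    ... | true  = refl
    ... | false = refl
    irreflexive (base s x) with s Fin.≟ s
    ... | yes refl rewrite dec-true (x Fin.≟ x) refl = refl
    ... | no ¬p = ⊥-elim (¬p refl)
    irreflexive (gad c g k) rewrite same-refl c | same-refl g | dec-true (k Fin.≟ k) refl = refl

  abstract
    iso : Fin (W + (total (size ∘ digraph) + 2 * (2 * suc t))) ↔ V
    iso = (↔-id _ ⊎-↔ ((Σ-iso (size ∘ digraph) ⊎-↔ ((2↔Bool ×-↔ ((2↔Bool ×-↔ ↔-id _) ↔-∘ *↔×)) ↔-∘ *↔×)) ↔-∘ +↔⊎)) ↔-∘ +↔⊎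

  open Build iso colour keeps irreflexive public

  private
    -- The opponent has no vertex left, and `c` takes those of the group by descending index, each
    -- move keeping all of smaller index.
    integer-position : ∀ c g r S → (∀ v → S v ≡ true → colour v ≡ c) →
      (∀ k → toℕ k < r → S (gad c g k) ≡ true) → r ≤ suc t → integer c r ≼[ c ] ⟪ S ⟫
    integer-position c g r S mono full r≤ = defend c (integer c r) S
      (λ v s e → ⊥-elim (absurd c (trans (sym (mono v s)) e))) (options c r mono full r≤)
      where
      absurd : ∀ c → c ≢ not c
      absurd true  ()
      absurd false ()
      step : ∀ c r → (∀ v → S v ≡ true → colour v ≡ c) → (∀ k → toℕ k < suc r → S (gad c g k) ≡ true) →
        suc r ≤ suc t → integer c r ⊲[ c ] ⟪ S ⟫
      step c r mono full r< = move c (integer c r) S v (full k (≤-reflexive (cong suc (toℕ-fromℕ< r<)))) refl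
        (integer-position c g r (S - v) (λ w e → mono w (proj₁ (∧-true e)))
          (λ k' lt → ∧-intro (full k' (≤-trans lt (n≤1+n r))) (kept k' lt)) (≤-trans (n≤1+n r) r<))
        where
        k = fromℕ< r<
        v = gad c g k
        kept : ∀ k' → toℕ k' < r → keeps v (gad c g k') ≡ true
        kept k' lt rewrite same-refl c | same-refl g
          | dec-false (k Fin.≟ k') (λ { refl → 1+n≰n (subst (λ x → suc x ≤ r) (toℕ-fromℕ< r<) lt) }) = refl
      options : ∀ c r → (∀ v → S v ≡ true → colour v ≡ c) → (∀ k → toℕ k < r → S (gad c g k) ≡ true) →
        r ≤ suc t → ∀ i → option c (integer c r) i ⊲[ c ] ⟪ S ⟫
      options true  (suc r) m f r≤ i = step true r m f r≤
      options false (suc r) m f r≤ i = step false r m f r≤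
      options true  zero m f r≤ ()
      options false zero m f r≤ ()

  -- The reply at the last vertex of the group leaves its other `t` vertices. By `gone` the only
  -- opposing group that it would spare is absent, so the rest is of one colour and worth at least
  -- `t` moves to `c`.
  reply : ∀ c g S → (∀ k → S (gad c g k) ≡ true) → (∀ k → S (gad (not c) (rival c g) k) ≡ false) →
    ∀ H → H ≼[ c ] integer c t → H ⊲[ c ] ⟪ S ⟫
  reply c g S own gone H p = move c H S v (own (fromℕ t)) refl
    (≼[]-trans c p (integer-position c g t (S - v) only
      (λ k lt → ∧-intro (own k) (kept k lt)) (n≤1+n t)))
    where
    v = gad c g (fromℕ t)
    kept : ∀ k → toℕ k < t → keeps v (gad c g k) ≡ true
    kept k lt rewrite same-refl c | same-refl g
      | dec-false (fromℕ t Fin.≟ k) (λ { refl → 1+n≰n (subst (λ x → suc x ≤ t) (toℕ-fromℕ t) lt) }) = refl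
    only : ∀ w → (S - v) w ≡ true → colour w ≡ c
    only (top s) e with () ← proj₂ (∧-true {S (top s)} e)
    only (base s x) e with () ← proj₂ (∧-true {S (base s x)} e)
    only (gad c' g' k) e with same c c' in e₁ | ∧-true {S (gad c' g' k)} e
    ... | true  | _ = sym (same-true c c' e₁)
    ... | false | s , r with same-true g' (rival c g) r
    ...   | refl = ⊥-elim (true≢false (trans (sym s) (subst (λ x → S (gad x (rival c g) k) ≡ false) (sym (other c c' e₁)) (gone k))))
      where
      other : ∀ c c' → same c c' ≡ false → c' ≡ not c
      other true  false _ = refl
      other false true  _ = refl

  module Copy (s : Fin W) where
    open Inverse iso

    private
      E = digraph s

      Same : (Fin (size D) → Bool) → (Fin (size E) → Bool) → Set
      Same T S = (∀ i → T i ≡ true → ∃ λ x → to i ≡ base s x × S x ≡ true) ×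
                 (∀ x → S x ≡ true → T (from (base s x)) ≡ true)

      keepsBase-self : ∀ x y → keepsBase s x s y ≡ not (does (y Fin.≟ x) ∨ arc E x y)
      keepsBase-self x y with s Fin.≟ s
      ... | yes refl = refl
      ... | no ¬p = ⊥-elim (¬p refl)

      delete-same : ∀ T S i x → Same T S → to i ≡ base s x → Same (delete D i T) (delete E x S)
      delete-same T S i x (f , g) e = f′ , g′
        where
        f′ : ∀ j → delete D i T j ≡ true → ∃ λ y → to j ≡ base s y × delete E x S y ≡ true
        f′ j d with p , q ← ∧-true (trans (sym (delete-keeps T i j)) d) with y , e′ , r ← f j p =
          y , e′ , ∧-intro r (trans (sym (keepsBase-self x y)) (trans (sym (cong₂ keeps e e′)) q))
        g′ : ∀ y → delete E x S y ≡ true → delete D i T (from (base s y)) ≡ true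
        g′ y d with p , q ← ∧-true {S y} d = trans (delete-keeps T i _)
          (∧-intro (g y p) (trans (cong₂ keeps e (strictlyInverseˡ (base s y))) (trans (keepsBase-self x y) q)))

      forth : ∀ T S c → Same T S → ∀ i → T i ≡ true → blue D i ≡ c →
        ∃ λ x → S x ≡ true × blue E x ≡ c × Same (delete D i T) (delete E x S)
      forth T S c m i p b with x , e , r ← proj₁ m i p = x , r , trans (sym (cong colour e)) b , delete-same T S i x m e

      back : ∀ T S c → Same T S → ∀ x → S x ≡ true → blue E x ≡ c →
        ∃ λ i → T i ≡ true × blue D i ≡ c × Same (delete D i T) (delete E x S)
      back T S c m x p b = from (base s x) , proj₂ m x p ,
        trans (cong colour (strictlyInverseˡ (base s x))) b , delete-same T S _ x m (strictlyInverseˡ (base s x))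

    copy : ∀ S → (∀ v → S v ≡ true → ∃ λ x → v ≡ base s x) → (∀ x → S (base s x) ≡ true) → ⟪ S ⟫ ≋ digraphGame E
    copy S only all =
      simulation D E Same (λ T S' m → forth T S' true m) (λ T S' m → back T S' false m)
        _ _ _ _ (count-≤ (S ∘ to)) (count-≤ (λ _ → true)) same′ ,
      simulation E D (λ S' T → Same T S') (λ S' T m → back T S' true m) (λ S' T m → forth T S' false m)
        _ _ _ _ (count-≤ (λ _ → true)) (count-≤ (S ∘ to)) same′
      where
      same′ : Same (S ∘ to) (λ _ → true)
      same′ = (λ i p → let x , e = only (to i) p in x , e , refl) ,
              (λ x _ → trans (cong S (strictlyInverseˡ (base s x))) (all x))

  module _ (X : Game) (bounded : ∀ c → X ≼[ c ] integer c t)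
    (offered : ∀ c i → ∃ λ s → owner s ≡ c × filled s ≡ true × option c X i ≼[ c ] digraphGame (digraph s))
    (legal : ∀ s → filled s ≡ true → digraphGame (digraph s) ⊲[ owner s ] X) where

    private
      full : V → Bool
      full _ = true

      swap : ∀ c {G H} → G ⊲[ not c ] H → H ⊲[ c ] G
      swap true  p = p
      swap false p = p

      top-copy : ∀ s → filled s ≡ true → ⟪ full - top s ⟫ ≋ digraphGame (digraph s)
      top-copy s f = Copy.copy s (full - top s) only all
        where
        only : ∀ v → keeps (top s) v ≡ true → ∃ λ x → v ≡ base s x
        only v e with filled s
        only (base s' x) e | true with s Fin.≟ s'
        ... | yes refl = x , refl
        all : ∀ x → keeps (top s) (base s x) ≡ true
        all x rewrite f = dec-true (s Fin.≟ s) refl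

      refute : ∀ c v → (∀ c' g k → keeps v (gad c' g k) ≡ neutral (not c) (gad c' g k)) → X ⊲[ c ] ⟪ full - v ⟫
      refute c v e = reply c true (full - v) (λ k → trans (e c true k) (own c)) (λ k → trans (e (not c) _ k) (gone c k)) X (bounded c)
        where
        own : ∀ c → same (not (not c)) c ≡ true
        own true  = refl
        own false = refl
        gone : ∀ c k → neutral (not c) (gad (not c) (rival c true) k) ≡ false
        gone true  k = refl
        gone false k = refl

      refute-gad : ∀ c g k → X ⊲[ c ] ⟪ full - gad (not c) g k ⟫
      refute-gad true true k =
        reply true true (full - gad false true k) (λ _ → refl) (λ _ → refl) X (bounded true)
      refute-gad true false k =
        reply true false (full - gad false false k) (λ _ → refl) (λ _ → refl) X (bounded true)
      refute-gad false true k =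
        reply false false (full - gad true true k) (λ _ → refl) (λ _ → refl) X (bounded false)
      refute-gad false false k =
        reply false true (full - gad true false k) (λ _ → refl) (λ _ → refl) X (bounded false)

      refuted : ∀ c v → colour v ≡ not c → X ⊲[ c ] ⟪ full - v ⟫
      refuted c (top s) e = byFilling (filled s) refl
        where
        byFilling : ∀ b → filled s ≡ b → X ⊲[ c ] ⟪ full - top s ⟫
        byFilling true  f = ⊲-≼[]-trans c (swap c (subst (digraphGame (digraph s) ⊲[_] X) e (legal s f)))
                              (≋⇒≼[] c (≋-sym (top-copy s f)))
        byFilling false f = refute c (top s) kept
          where
          kept : ∀ c' g k → keeps (top s) (gad c' g k) ≡ neutral (not c) (gad c' g k)
          kept c' g k rewrite f | e = refl
      refuted c (base s x) e = refute c (base s x) λ c' g k → cong (λ b → neutral b (gad c' g k)) e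
      refuted c (gad c' g k) refl = refute-gad c g k

      accepted : ∀ c i → option c X i ⊲[ c ] ⟪ full ⟫
      accepted c i with s , e , f , p ← offered c i =
        move c _ full (top s) refl e (≼[]-trans c p (≋⇒≼[] c (≋-sym (top-copy s f))))

    -- Each player `c` secures `X`: options of `X` are matched through `offered`, an opposing move
    -- into a filled slot is no better than `legal` permits, and any other opposing move is answered
    -- in the gadget, where `bounded` makes `integer c t` good enough.
    realised : digraphGame D ≋ X
    realised = defend false X full (λ v _ → refuted false v) (accepted false) ,
               defend true X full (λ v _ → refuted true v) (accepted true)

slots-realisable : ∀ {W} (owner filled : Fin W → Bool) (digraph : Fin W → Digraph) t X →
  (∀ c → X ≼[ c ] integer c t) →
  (∀ c i → ∃ λ s → owner s ≡ c × filled s ≡ true × option c X i ≼[ c ] digraphGame (digraph s)) →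
  (∀ s → filled s ≡ true → digraphGame (digraph s) ⊲[ owner s ] X) →
  RealisableOn (W + (total (size ∘ digraph) + 2 * (2 * suc t))) X
slots-realisable owner filled digraph t X p q r = Slots.D owner filled digraph t , refl ,
  ≋⇒≈ (Slots.realised owner filled digraph t X p q r)

-- The recursion from one day to the next

≈-trans : ∀ {G H K} → G ≈ H → H ≈ K → G ≈ K
≈-trans p q X = trans (p X) (q X)

FLe-weaken : ∀ {b M N} → M ≤ N → FLe b M → FLe b N
FLe-weaken le f X B with n , p , r ← f X B = n , ≤-trans p le , r

≤-check : ∀ {m n} → (m ≤ᵇ n) ≡ true → m ≤ n
≤-check {m} {n} e = ≤ᵇ⇒≤ m n (subst T (sym e) tt)

-- A cover of the games born by day `b` by `w` chains, as a function on game trees.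
Slotting : ℕ → ℕ → Set
Slotting b w = Σ (Game → Fin w) λ slot →
  ∀ G H → Born b G → Born b H → slot G ≡ slot H → G ≼ H ⊎ H ≼ G

Slotting-weaken : ∀ {b w w'} → w ≤ w' → Slotting b w → Slotting b w'
Slotting-weaken le (slot , ch) = (λ G → inject≤ (slot G) le) ,
  λ G H bG bH e → ch G H bG bH (inject≤-injective le le _ _ e)

comparable : ∀ c {G H} → G ≼ H ⊎ H ≼ G → G ≼[ c ] H ⊎ H ≼[ c ] G
comparable true  p = p
comparable false (inj₁ p) = inj₂ p
comparable false (inj₂ p) = inj₁ p

best : ∀ c {n} (f : Fin n → Game) (P : Fin n → Bool) →
  (∀ i j → P i ≡ true → P j ≡ true → f i ≼[ c ] f j ⊎ f j ≼[ c ] f i) →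
  (∀ i → P i ≢ true) ⊎ ∃ λ i → P i ≡ true × (∀ j → P j ≡ true → f j ≼[ c ] f i)
best c {zero}  f P t = inj₁ λ ()
best c {suc n} f P t with P zero in e | best c (f ∘ suc) (P ∘ suc) (λ i j → t (suc i) (suc j))
... | false | inj₁ none = inj₁ λ { zero p → true≢false (trans (sym p) e) ; (suc i) p → none i p }
... | false | inj₂ (i , p , m) = inj₂ (suc i , p ,
  λ { zero q → ⊥-elim (true≢false (trans (sym q) e)) ; (suc j) q → m j q })
... | true | inj₁ none = inj₂ (zero , e , λ { zero q → ≼[]-refl c (f zero) ; (suc j) q → ⊥-elim (none j q) })
... | true | inj₂ (i , p , m) with t zero (suc i) e p
...   | inj₁ q = inj₂ (suc i , p , λ { zero _ → q ; (suc j) r → m j r })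
...   | inj₂ q = inj₂ (zero , e , λ { zero _ → ≼[]-refl c (f zero) ; (suc j) r → ≼[]-trans c (m j r) q })

module Step {b w s : ℕ} (sl : Slotting b w) (realise : FLe b s) (G : Game) (born : Born (suc b) G) where

  slot : Game → Fin w
  slot = proj₁ sl

  Born-option : ∀ c i → Born b (option c G i)
  Born-option true  = Born-left b G born
  Born-option false = Born-right b G born

  -- A digraph for a best option of player `c` in chain `m`. If no option lies in that chain, the
  -- slot counts as not filled and holds the empty digraph.
  record Content (c : Bool) (m : Fin w) : Set where
    field
      present : Bool
      content : Digraph
      small   : size content ≤ s
      legal   : present ≡ true → ∃ λ i → digraphGame content ≋ option c G i
      maximal : ∀ i → slot (option c G i) ≡ m → present ≡ true × option c G i ≼[ c ] digraphGame content

  abstract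
    fill : ∀ c m → Content c m
    fill c m with best c (option c G) (λ i → does (slot (option c G i) Fin.≟ m)) totally
      where
      same : ∀ i → does (slot (option c G i) Fin.≟ m) ≡ true → slot (option c G i) ≡ m
      same i e with slot (option c G i) Fin.≟ m
      ... | yes p = p
      totally : ∀ i j → does (slot (option c G i) Fin.≟ m) ≡ true → does (slot (option c G j) Fin.≟ m) ≡ true →
          option c G i ≼[ c ] option c G j ⊎ option c G j ≼[ c ] option c G i
      totally i j p q = comparable c (proj₂ sl _ _ (Born-option c i) (Born-option c j) (trans (same i p) (sym (same j q))))
    ... | inj₁ none = record
      { present = false
      ; content = record { size = 0 ; blue = λ () ; arc = λ () }
      ; small = z≤n
      ; legal = λ ()
      ; maximal = λ i e → ⊥-elim (none i (dec-true (slot (option c G i) Fin.≟ m) e))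
      }
    ... | inj₂ (i , p , m′) with realise (option c G i) (option c G i , Born⇒birthday b _ (Born-option c i) , λ _ → refl)
    ...   | n , n≤s , D , refl , e = record
      { present = true
      ; content = D
      ; small = n≤s
      ; legal = λ _ → i , ≈⇒≋ e
      ; maximal = λ j q → refl , ≼[]-trans c (m′ j (dec-true (slot (option c G j) Fin.≟ m) q)) (≋⇒≼[] c (≋-sym (≈⇒≋ e)))
      }

  sideOf : Fin w ⊎ Fin w → Bool × Fin w
  sideOf (inj₁ m) = true , m
  sideOf (inj₂ m) = false , m

  side : Fin (w + w) → Bool × Fin w
  side k = sideOf (splitAt w k)

  at : ∀ c m → ∃ λ k → side k ≡ (c , m)
  at true  m = m ↑ˡ w , cong sideOf (splitAt-↑ˡ w m w)
  at false m = w ↑ʳ m , cong sideOf (splitAt-↑ʳ w w m)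

  contentOf : (p : Bool × Fin w) → Content (proj₁ p) (proj₂ p)
  contentOf (c , m) = fill c m

  offers : ∀ c i → ∃ λ p → proj₁ p ≡ c × Content.present (contentOf p) ≡ true ×
    option c G i ≼[ c ] digraphGame (Content.content (contentOf p))
  offers c i with p , q ← Content.maximal (fill c (slot (option c G i))) i refl = (c , slot (option c G i)) , refl , p , q

  ownerOf filled : Fin (w + w) → Bool
  ownerOf k = proj₁ (side k)
  filled k  = Content.present (contentOf (side k))

  digraph : Fin (w + w) → Digraph
  digraph k = Content.content (contentOf (side k))

  offered : ∀ c i → ∃ λ k → ownerOf k ≡ c × filled k ≡ true × option c G i ≼[ c ] digraphGame (digraph k)
  offered c i with (c' , m) , o ← offers c i with k , e ← at c' m =
    k , subst (λ p → proj₁ p ≡ c × Content.present (contentOf p) ≡ true ×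
      option c G i ≼[ c ] digraphGame (Content.content (contentOf p))) (sym e) o

  allowed : ∀ p → Content.present (contentOf p) ≡ true → digraphGame (Content.content (contentOf p)) ⊲[ proj₁ p ] G
  allowed (c , m) f with i , e ← Content.legal (fill c m) f = ≼-⊲[]-trans c (≋⇒≼[] c e) (⊲[]-option c G i)

  total-≤ : ∀ {W} (f : Fin W → ℕ) → (∀ k → f k ≤ s) → total f ≤ W * s
  total-≤ {zero}  f p = z≤n
  total-≤ {suc W} f p = +-mono-≤ (p zero) (total-≤ (f ∘ suc) (p ∘ suc))

  realisable : ∃ λ n → n ≤ (w + w) + ((w + w) * s + 2 * (2 * (2 + b))) × RealisableOn n G
  realisable = _ ,
    +-monoʳ-≤ (w + w) (+-monoˡ-≤ (2 * (2 * (2 + b))) (total-≤ (size ∘ digraph) (λ k → Content.small (contentOf (side k))))) ,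
    slots-realisable ownerOf filled digraph (suc b) G (λ c → Born⇒≼[] c (suc b) G born) offered (λ k → allowed (side k))

-- There are `2 w` slots, each with one vertex and a digraph of size at most `s`. The gadget uses
-- `t = b + 1`, because a game born by day `b + 1` lies between the integers `-(b + 1)` and `b + 1`,
-- and so has `4 (b + 2)` vertices.
FLe-suc : ∀ {b w s} → Slotting b w → FLe b s → FLe (suc b) ((w + w) + ((w + w) * s + 2 * (2 * (2 + b))))
FLe-suc {b} sl r X (G , bd , G≈X) with n , p , D , e , q ← Step.realisable sl r G (birthday⇒Born _ G bd) =
  n , p , D , e , ≈-trans q G≈X

-- Chains of games

leqBits : List Bool → List Bool → Bool
leqBits [] [] = true
leqBits (a ∷ as) (b ∷ bs) = (not a ∨ b) ∧ leqBits as bs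
leqBits _ _ = false

leqBits-trans : ∀ as bs cs → leqBits as bs ≡ true → leqBits bs cs ≡ true → leqBits as cs ≡ true
leqBits-trans [] [] [] p q = refl
leqBits-trans (false ∷ as) (b ∷ bs) (c ∷ cs) p q = leqBits-trans as bs cs p (proj₂ (∧-true q))
leqBits-trans (true ∷ as) (true ∷ bs) (true ∷ cs) p q = leqBits-trans as bs cs p q

leqBits-refl : ∀ as → leqBits as as ≡ true
leqBits-refl [] = refl
leqBits-refl (true ∷ as)  = leqBits-refl as
leqBits-refl (false ∷ as) = leqBits-refl as

private
  lefts-mono : ∀ us as bs {x} → leqBits as bs ≡ true → x ∈ lefts us as → x ∈ lefts us bs
  lefts-mono ((true , r) ∷ us) (true ∷ as) (true ∷ bs) p (here e) = here e
  lefts-mono ((true , r) ∷ us) (true ∷ as) (true ∷ bs) p (there m) = there (lefts-mono us as bs p m)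
  lefts-mono ((true , r) ∷ us) (false ∷ as) (true ∷ bs) p m = there (lefts-mono us as bs p m)
  lefts-mono ((true , r) ∷ us) (false ∷ as) (false ∷ bs) p m = lefts-mono us as bs p m
  lefts-mono ((false , r) ∷ us) (true ∷ as) (true ∷ bs) p m = lefts-mono us as bs p m
  lefts-mono ((false , r) ∷ us) (false ∷ as) (true ∷ bs) p m = lefts-mono us as bs p m
  lefts-mono ((false , r) ∷ us) (false ∷ as) (false ∷ bs) p m = lefts-mono us as bs p m

  rights-mono : ∀ us as bs {x} → leqBits as bs ≡ true → x ∈ rights us bs → x ∈ rights us as
  rights-mono ((false , r) ∷ us) (false ∷ as) (false ∷ bs) p (here e) = here e
  rights-mono ((false , r) ∷ us) (false ∷ as) (false ∷ bs) p (there m) = there (rights-mono us as bs p m)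
  rights-mono ((false , r) ∷ us) (false ∷ as) (true ∷ bs) p m = there (rights-mono us as bs p m)
  rights-mono ((false , r) ∷ us) (true ∷ as) (true ∷ bs) p m = rights-mono us as bs p m
  rights-mono ((true , r) ∷ us) (true ∷ as) (true ∷ bs) p m = rights-mono us as bs p m
  rights-mono ((true , r) ∷ us) (false ∷ as) (true ∷ bs) p m = rights-mono us as bs p m
  rights-mono ((true , r) ∷ us) (false ∷ as) (false ∷ bs) p m = rights-mono us as bs p m

-- More positive answers give more Left options and fewer Right options.
gameOf-mono : ∀ us as bs → leqBits as bs ≡ true → gameOf us as ≼ gameOf us bs
gameOf-mono us as bs p = ≼-intro (gameOf us as) (gameOf us bs)
  (λ i → let j , e = fromLists-left (lefts us bs) (rights us bs) (lefts-mono us as bs p (∈-lookup {xs = lefts us as} i))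
         in ⊲-byLeft _ (gameOf us bs) j (≡⇒≼ (sym e)))
  (λ j → let i , e = fromLists-right (lefts us as) (rights us as) (rights-mono us as bs p (∈-lookup {xs = rights us bs} j))
         in ⊲-byRight (gameOf us as) _ i (≡⇒≼ e))

Ascending : List (List Bool) → Set
Ascending = AllPairs (λ as bs → leqBits as bs ≡ true)

-- First fit: `x` is put at the bottom of the first chain whose least element, its head, is above
-- `x`.
insert : List Bool → List (List (List Bool)) → List (List (List Bool))
insert x [] = (x ∷ []) ∷ []
insert x ([] ∷ cs) = (x ∷ []) ∷ cs
insert x ((y ∷ c) ∷ cs) = if leqBits x y then (x ∷ y ∷ c) ∷ cs else (y ∷ c) ∷ insert x cs

chains : List (List Bool) → List (List (List Bool))
chains [] = []
chains (x ∷ xs) = insert x (chains xs)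

insert-ascending : ∀ x cs → All Ascending cs → All Ascending (insert x cs)
insert-ascending x [] [] = ([] ∷ []) ∷ []
insert-ascending x ([] ∷ cs) (_ ∷ as) = ([] ∷ []) ∷ as
insert-ascending x ((y ∷ c) ∷ cs) ((p ∷ q) ∷ as) with leqBits x y in e
... | true  = ((e ∷ All.map (λ {z} → leqBits-trans x y z e) p) ∷ p ∷ q) ∷ as
... | false = (p ∷ q) ∷ insert-ascending x cs as

chains-ascending : ∀ xs → All Ascending (chains xs)
chains-ascending [] = []
chains-ascending (x ∷ xs) = insert-ascending x (chains xs) (chains-ascending xs)

insert-here : ∀ x cs → Any (x ∈_) (insert x cs)
insert-here x [] = here (here refl)
insert-here x ([] ∷ cs) = here (here refl)
insert-here x ((y ∷ c) ∷ cs) with leqBits x y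
... | true  = here (here refl)
... | false = there (insert-here x cs)

insert-there : ∀ x cs {z} → Any (z ∈_) cs → Any (z ∈_) (insert x cs)
insert-there x ([] ∷ cs) (here ())
insert-there x ([] ∷ cs) (there p) = there p
insert-there x ((y ∷ c) ∷ cs) p with leqBits x y
insert-there x ((y ∷ c) ∷ cs) (here p)  | true  = here (there p)
insert-there x ((y ∷ c) ∷ cs) (there p) | true  = there p
insert-there x ((y ∷ c) ∷ cs) (here p)  | false = here p
insert-there x ((y ∷ c) ∷ cs) (there p) | false = there (insert-there x cs p)

chains-∈ : ∀ xs {x} → x ∈ xs → Any (x ∈_) (chains xs)
chains-∈ (x ∷ xs) (here refl) = insert-here x (chains xs)
chains-∈ (x ∷ xs) (there p) = insert-there x (chains xs) (chains-∈ xs p)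

ascending-comparable : ∀ {c} → Ascending c → ∀ {x y} → x ∈ c → y ∈ c → leqBits x y ≡ true ⊎ leqBits y x ≡ true
ascending-comparable (p ∷ ps) {x} (here refl) (here refl) = inj₁ (leqBits-refl x)
ascending-comparable (p ∷ ps) (here refl) (there q) = inj₁ (All.lookup p q)
ascending-comparable (p ∷ ps) (there q) (here refl) = inj₂ (All.lookup p q)
ascending-comparable (p ∷ ps) (there q) (there r) = ascending-comparable ps q r

-- A game is sent to the chain containing its code. Comparable codes give comparable games by
-- `gameOf-mono` and `gameOf-≋`.
chain-slotting : ∀ b rs → Covers b rs → Slotting (suc b) (length (chains (codes rs)))
chain-slotting b rs cov = slot , ch
  where
  us = reversedProbes rs
  cs = chains (codes rs)
  place : ∀ G → Any (codeOf rs G ∈_) cs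
  place G = chains-∈ (codes rs) (codeOf-∈ rs G)
  slot : Game → Fin (length cs)
  slot G = index (place G)
  same-chain : ∀ G H → slot G ≡ slot H → leqBits (codeOf rs G) (codeOf rs H) ≡ true ⊎ leqBits (codeOf rs H) (codeOf rs G) ≡ true
  same-chain G H e = ascending-comparable (All.lookup (chains-ascending (codes rs)) (∈-lookup {xs = cs} (slot G)))
    (lookup-index (place G)) (subst (λ k → codeOf rs H ∈ lookup cs k) (sym e) (lookup-index (place H)))
  below : ∀ G H → Born (suc b) G → Born (suc b) H → leqBits (codeOf rs G) (codeOf rs H) ≡ true → G ≼ H
  below G H bG bH p = ≼-trans G _ H (proj₁ (gameOf-≋ b rs us cov (∈-probes rs) G bG))
    (≼-trans _ _ H (gameOf-mono us _ _ p) (proj₂ (gameOf-≋ b rs us cov (∈-probes rs) H bH)))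
  ch : ∀ G H → Born (suc b) G → Born (suc b) H → slot G ≡ slot H → G ≼ H ⊎ H ≼ G
  ch G H bG bH e with same-chain G H e
  ... | inj₁ p = inj₁ (below G H bG bH p)
  ... | inj₂ p = inj₂ (below H G bH bG p)

insert-⊆ : ∀ x cs {z} → Any (z ∈_) (insert x cs) → z ≡ x ⊎ Any (z ∈_) cs
insert-⊆ x [] (here (here p)) = inj₁ p
insert-⊆ x ([] ∷ cs) (here (here p)) = inj₁ p
insert-⊆ x ([] ∷ cs) (there p) = inj₂ (there p)
insert-⊆ x ((y ∷ c) ∷ cs) p with leqBits x y
insert-⊆ x ((y ∷ c) ∷ cs) (here (here p))  | true  = inj₁ p
insert-⊆ x ((y ∷ c) ∷ cs) (here (there p)) | true  = inj₂ (here p)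
insert-⊆ x ((y ∷ c) ∷ cs) (there p) | true  = inj₂ (there p)
insert-⊆ x ((y ∷ c) ∷ cs) (here p)  | false = inj₂ (here p)
insert-⊆ x ((y ∷ c) ∷ cs) (there p) | false with insert-⊆ x cs p
... | inj₁ q = inj₁ q
... | inj₂ q = inj₂ (there q)

chains-⊆ : ∀ xs {x} → Any (x ∈_) (chains xs) → x ∈ xs
chains-⊆ (y ∷ xs) p with insert-⊆ y (chains xs) p
... | inj₁ q = here q
... | inj₂ q = there (chains-⊆ xs q)

map-agree : ∀ {A B : Set} {f g : A → B} xs → (∀ x → x ∈ xs → f x ≡ g x) → map f xs ≡ map g xs
map-agree [] e = refl
map-agree (x ∷ xs) e = cong₂ _∷_ (e x (here refl)) (map-agree xs (λ y p → e y (there p)))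

reverse-∈ : ∀ {A : Set} (xs : List A) {ys x} → x ∈ xs ʳ++ ys → x ∈ xs ⊎ x ∈ ys
reverse-∈ [] p = inj₂ p
reverse-∈ (x ∷ xs) p with reverse-∈ xs p
... | inj₁ q = inj₁ (there q)
... | inj₂ (here q) = inj₁ (here q)
... | inj₂ (there q) = inj₂ q

∈-probes⁻ : ∀ rs {c r} → (c , r) ∈ reversedProbes rs → r ∈ rs
∈-probes⁻ rs p with reverse-∈ (probes rs) p
... | inj₁ q with ∈-++⁻ (map (false ,_) rs) q
...   | inj₁ r with _ , x , refl ← ∈-map⁻ _ r = x
...   | inj₂ r with reverse-∈ (map (true ,_) rs) r
...     | inj₁ r′ with _ , x , refl ← ∈-map⁻ _ r′ = x

-- The heights of a game in the chains of the games of the previous day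

trues : List Bool → ℕ
trues [] = 0
trues (true ∷ bs)  = suc (trues bs)
trues (false ∷ bs) = trues bs

trues-≤ : ∀ bs → trues bs ≤ length bs
trues-≤ [] = z≤n
trues-≤ (true ∷ bs)  = s≤s (trues-≤ bs)
trues-≤ (false ∷ bs) = m≤n⇒m≤1+n (trues-≤ bs)

-- The number `(l + 1)(l + 2) / 2` of pairs `q ≤ p ≤ l`.
triangle : ℕ → ℕ
triangle zero    = 1
triangle (suc l) = triangle l + (2 + l)

clip : ∀ n → ℕ → Fin (suc n)
clip zero    q       = zero
clip (suc n) zero    = zero
clip (suc n) (suc q) = suc (clip n q)

clip-injective : ∀ n {q q'} → q ≤ n → q' ≤ n → clip n q ≡ clip n q' → q ≡ q'
clip-injective zero    z≤n z≤n e = refl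
clip-injective (suc n) {zero}  {zero}  p p' e = refl
clip-injective (suc n) {suc q} {suc q'} (s≤s p) (s≤s p') e = cong suc (clip-injective n p p' (Finₚ.suc-injective e))

-- Encodes the pairs q ≤ p ≤ l; other arguments give junk.
pair : ∀ l → ℕ → ℕ → Fin (triangle l)
pair zero    p q = zero
pair (suc l) p q = if p ≡ᵇ suc l then triangle l ↑ʳ clip (suc l) q else pair l p q ↑ˡ (2 + l)

private
  ↑ˡ≢↑ʳ : ∀ {m n} (i : Fin m) (j : Fin n) → i ↑ˡ n ≢ m ↑ʳ j
  ↑ˡ≢↑ʳ {m} {n} i j e with trans (sym (splitAt-↑ˡ m i n)) (trans (cong (splitAt m) e) (splitAt-↑ʳ m n j))
  ... | ()

pair-injective : ∀ l {p q p' q'} → p ≤ l → q ≤ p → p' ≤ l → q' ≤ p' → pair l p q ≡ pair l p' q' → p ≡ p' × q ≡ q'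
pair-injective zero z≤n z≤n z≤n z≤n e = refl , refl
pair-injective (suc l) {p} {q} {p'} {q'} a b a' b' e with p ≡ᵇ suc l in eq | p' ≡ᵇ suc l in eq'
... | true  | true  = trans P (sym P') , clip-injective (suc l) (≤-trans b a) (≤-trans b' a') (↑ʳ-injective (triangle l) _ _ e)
  where
  P  = ≡ᵇ⇒≡ p (suc l) (subst T (sym eq) tt)
  P' = ≡ᵇ⇒≡ p' (suc l) (subst T (sym eq') tt)
... | true  | false = ⊥-elim (↑ˡ≢↑ʳ _ _ (sym e))
... | false | true  = ⊥-elim (↑ˡ≢↑ʳ _ _ e)
... | false | false = pair-injective l (smaller a eq) b (smaller a' eq') b' (↑ˡ-injective (2 + l) _ _ e)
  where
  smaller : ∀ {p} → p ≤ suc l → (p ≡ᵇ suc l) ≡ false → p ≤ l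
  smaller {p} a eq = ≤-pred (≤∧≢⇒< a λ r → subst T eq (≡⇒≡ᵇ p (suc l) r))




-- The shape of the answers along an ascending chain: trues followed by falses, hence determined by
-- the length and the number of trues.
Falling : List Bool → Set
Falling = AllPairs (λ a b → b ≡ true → a ≡ true)

falling-false : ∀ {bs} → All (λ b → b ≡ true → false ≡ true) bs → trues bs ≡ 0
falling-false [] = refl
falling-false {true ∷ bs}  (p ∷ ps) with () ← p refl
falling-false {false ∷ bs} (p ∷ ps) = falling-false ps

falling-≡ : ∀ {as bs} → length as ≡ length bs → Falling as → Falling bs → trues as ≡ trues bs → as ≡ bs
falling-≡ {[]} {[]} l f g e = refl
falling-≡ {true ∷ as}  {true ∷ bs}  l (_ ∷ f) (_ ∷ g) e = cong (true ∷_) (falling-≡ (suc-injective l) f g (suc-injective e))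
falling-≡ {false ∷ as} {false ∷ bs} l (_ ∷ f) (_ ∷ g) e = cong (false ∷_) (falling-≡ (suc-injective l) f g e)
falling-≡ {true ∷ as}  {false ∷ bs} l f (p ∷ _) e with () ← trans e (falling-false p)
falling-≡ {false ∷ as} {true ∷ bs}  l (p ∷ _) g e with () ← trans (sym (falling-false p)) e

triangles : List (List (List Bool)) → ℕ
triangles []       = 1
triangles (c ∷ cs) = triangle (length c) * triangles cs

search : ∀ {n} (f : Fin n → Bool) → (∃ λ i → f i ≡ true) ⊎ (∀ i → f i ≡ false)
search {n} f with anyFin n f in e
... | true  = inj₁ (anyFin-true n f e)
... | false = inj₂ (anyFin-false n f e)

-- A game that is not born the day before satisfies g ⊲ G whenever g ≼ G, so it
-- has two ordered heights in every chain, and these determine it.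
module Heights (b : ℕ) (rs : List Game) (covers : Covers b rs) where

  us = reversedProbes rs
  cs = chains (codes rs)
  N  = length (codes rs)

  member : List Bool → Game
  member = gameOf us

  profile : Bool → Game → List (List Bool) → List Bool
  profile c G = map (λ e → holds G (c , member e))

  heights : Game → ∀ cs → Fin (triangles cs)
  heights G []       = zero
  heights G (c ∷ cs) = combine (pair (length c) (trues (profile true G c)) (trues (profile false G c))) (heights G cs)

  -- Games equal to one listed for day `b + 1` are numbered by their position in the list, all
  -- others by their heights.
  slot : Game → Fin (N + triangles cs)
  slot G with search (λ i → ≋? G (member (lookup (codes rs) i)))
  ... | inj₁ (i , _) = i ↑ˡ triangles cs
  ... | inj₂ _       = N ↑ʳ heights G cs

  New : Game → Set
  New G = ∀ i → ≋? G (member (lookup (codes rs) i)) ≡ false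

  private
    length-profile : ∀ c G H es → length (profile c G es) ≡ length (profile c H es)
    length-profile c G H []       = refl
    length-profile c G H (e ∷ es) = cong suc (length-profile c G H es)

    length-profile′ : ∀ c G es → length (profile c G es) ≡ length es
    length-profile′ c G []       = refl
    length-profile′ c G (e ∷ es) = cong suc (length-profile′ c G es)

    falling : ∀ c G {es} → Ascending es → Falling (profile c G es)
    falling c G [] = []
    falling c G {e ∷ es} (p ∷ ps) = all p ∷ falling c G ps
      where
      all : ∀ {es} → All (λ e' → leqBits e e' ≡ true) es →
        All (λ x → x ≡ true → holds G (c , member e) ≡ true) (profile c G es)
      all [] = []
      all {e' ∷ es} (q ∷ qs) = below c ∷ all qs
        where
        below : ∀ c → holds G (c , member e') ≡ true → holds G (c , member e) ≡ true
        below true  = implies-sound G (true , member e') (true , member e) (≼⇒leb (member e) (member e') (gameOf-mono us e e' q))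
        below false = implies-sound G (false , member e') (false , member e) (≼⇒leb (member e) (member e') (gameOf-mono us e e' q))

    new-⊲ : ∀ G → New G → ∀ {e} → e ∈ codes rs → holds G (false , member e) ≡ true → holds G (true , member e) ≡ true
    new-⊲ G new {e} m p with leb G (member e) in q
    ... | false = refl
    ... | true  = trans (sym (new (index m))) (subst (λ x → ≋? G (member x) ≡ true) (lookup-index m)
                    (≋?-complete G (member e) (leb-true G (member e) q , leb-true (member e) G p)))

    ordered : ∀ G → New G → ∀ es → (∀ {e} → e ∈ es → e ∈ codes rs) → trues (profile false G es) ≤ trues (profile true G es)
    ordered G new [] m = z≤n
    ordered G new (e ∷ es) m with leb (member e) G in p | holds G (true , member e) in q
    ... | true  | true  = s≤s (ordered G new es (m ∘ there))
    ... | false | true  = m≤n⇒m≤1+n (ordered G new es (m ∘ there))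
    ... | false | false = ordered G new es (m ∘ there)
    ... | true  | false with () ← trans (sym q) (new-⊲ G new (m (here refl)) p)

    bound : ∀ k G c → trues (profile k G c) ≤ length c
    bound k G c = ≤-trans (trues-≤ (profile k G c)) (≤-reflexive (length-profile′ k G c))

    agree : ∀ G H → New G → New H → ∀ cs → All Ascending cs → (∀ {c} → c ∈ cs → ∀ {e} → e ∈ c → e ∈ codes rs) →
      heights G cs ≡ heights H cs → ∀ {e} → Any (e ∈_) cs → ∀ k → holds G (k , member e) ≡ holds H (k , member e)
    agree G H nG nH (c ∷ cs) (a ∷ as) m eq {e} p
      with e₁ , e₂ ← combine-injective {triangle (length c)} {triangles cs} _ _ _ _ eq
      with e₃ , e₄ ← pair-injective (length c) (bound true G c) (ordered G nG c (m (here refl)))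
                                               (bound true H c) (ordered H nH c (m (here refl))) e₁ = at p
      where
      same : ∀ k → profile k G c ≡ profile k H c
      same true  = falling-≡ (length-profile true G H c) (falling true G a) (falling true H a) e₃
      same false = falling-≡ (length-profile false G H c) (falling false G a) (falling false H a) e₄
      pick : ∀ k {c} → profile k G c ≡ profile k H c → e ∈ c → holds G (k , member e) ≡ holds H (k , member e)
      pick k q (here refl) = proj₁ (∷-injective q)
      pick k q (there x) = pick k (proj₂ (∷-injective q)) x
      at : Any (e ∈_) (c ∷ cs) → ∀ k → holds G (k , member e) ≡ holds H (k , member e)
      at (here x)  k = pick k (same k) x
      at (there x) k = agree G H nG nH cs as (m ∘ there) e₂ x k

    -- For new games, equal heights mean equal answers to the probes by all games listed for day
    -- `b + 1`, and these answers determine the value.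
    slot-≋ : ∀ G H → Born (suc (suc b)) G → Born (suc (suc b)) H → slot G ≡ slot H → G ≋ H
    slot-≋ G H bG bH e with search (λ i → ≋? G (member (lookup (codes rs) i))) | search (λ i → ≋? H (member (lookup (codes rs) i)))
    ... | inj₁ (i , p) | inj₁ (j , q) with refl ← ↑ˡ-injective (triangles cs) i j e =
      ≋-trans (≋?-sound G _ p) (≋-sym (≋?-sound H _ q))
    ... | inj₁ (i , p) | inj₂ _ = ⊥-elim (↑ˡ≢↑ʳ _ _ e)
    ... | inj₂ _ | inj₁ (j , q) = ⊥-elim (↑ˡ≢↑ʳ _ _ (sym e))
    ... | inj₂ nG | inj₂ nH = ≋-trans (determined G bG)
          (subst (λ x → gameOf vs x ≋ H) (sym codes≡) (≋-sym (determined H bH)))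
      where
      vs = reversedProbes (nextCover rs)
      determined : ∀ G → Born (suc (suc b)) G → G ≋ gameOf vs (codeOf (nextCover rs) G)
      determined = gameOf-≋ (suc b) (nextCover rs) vs (nextCover-covers b rs covers) (∈-probes (nextCover rs))
      probe≡ : ∀ k r → r ∈ nextCover rs → holds G (k , r) ≡ holds H (k , r)
      probe≡ k r m with x , y , refl ← ∈-map⁻ member m =
        agree G H nG nH cs (chains-ascending (codes rs)) (λ c∈ e∈ → chains-⊆ (codes rs) (Any.map (λ { refl → e∈ }) c∈))
          (↑ʳ-injective N _ _ e) (chains-∈ (codes rs) y) k
      codes≡ : codeOf (nextCover rs) G ≡ codeOf (nextCover rs) H
      codes≡ = map-agree vs λ { (k , r) m → probe≡ k r (∈-probes⁻ (nextCover rs) m) }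

  -- Each slot contains a single value, so a bound on the number of games serves as a number of
  -- chains.
  slotting : Slotting (suc (suc b)) (N + triangles cs)
  slotting = slot , λ G H bG bH e → inj₁ (proj₁ (slot-≋ G H bG bH e))

-- Small digraphs are given by the number n of vertices and the binary expansions
-- of the set of blue vertices and of the set of arcs (u → v has index u n + v).

halve : ℕ → ℕ → ℕ
halve zero    k = k
halve (suc i) k = halve i (k / 2)

bitAt : ℕ → ℕ → Bool
bitAt k i = (halve i k % 2) ≡ᵇ 1

decode : ℕ × ℕ × ℕ → Digraph
decode (n , c , a) = record { size = n ; blue = λ v → bitAt c (toℕ v) ; arc = λ u v → bitAt a (toℕ u * n + toℕ v) }

matches : ℕ → List Game → List (ℕ × ℕ × ℕ) → Bool
matches N [] _ = true
matches N (r ∷ rs) [] = false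
matches N (r ∷ rs) (d ∷ ds) = (proj₁ d ≤ᵇ N) ∧ (≋? (digraphGame (decode d)) r ∧ matches N rs ds)

tabulated : ∀ N rs ds → matches N rs ds ≡ true → ∀ {r} → r ∈ rs → ∃ λ D → size D ≤ N × digraphGame D ≋ r
tabulated N (r ∷ rs) (d ∷ ds) e (here refl) with p , q ← ∧-true e =
  decode d , ≤-check p , ≋?-sound _ r (proj₁ (∧-true q))
tabulated N (r ∷ rs) (d ∷ ds) e (there m) with p , q ← ∧-true {proj₁ d ≤ᵇ N} e =
  tabulated N rs ds (proj₂ (∧-true {≋? (digraphGame (decode d)) r} q)) m

FLe-tabulated : ∀ b N ds → matches N (cover b) ds ≡ true → FLe b N
FLe-tabulated b N ds e X (G , bd , G≈X) with r , m , G≋r ← cover-covers b G (birthday⇒Born b G bd)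
  with D , s , D≋r ← tabulated N (cover b) ds e m =
  size D , s , D , refl , ≈-trans (≋⇒≈ (≋-trans D≋r (≋-sym G≋r))) G≈X

-- Upper bounds by tables and by the recursion

F0≤ : FLe 0 0
F0≤ = FLe-tabulated 0 0 ((0 , 0 , 0) ∷ []) refl

F1≤ : FLe 1 2
F1≤ = FLe-tabulated 1 2 ((1 , 0 , 0) ∷ (2 , 1 , 6) ∷ (0 , 0 , 0) ∷ (1 , 1 , 0) ∷ []) refl

F2≤ : FLe 2 4
-- One digraph for each of the 22 values born by day 2, in the order of `cover 2`.
F2≤ = FLe-tabulated 2 4
  ( (2 , 0 , 0) ∷ (3 , 1 , 10) ∷ (4 , 3 , 856) ∷ (3 , 1 , 14) ∷ (4 , 3 , 910) ∷ (4 , 3 , 780)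
  ∷ (1 , 0 , 0) ∷ (2 , 1 , 4) ∷ (4 , 3 , 2904) ∷ (3 , 1 , 46) ∷ (4 , 3 , 6990) ∷ (4 , 3 , 6988)
  ∷ (0 , 0 , 0) ∷ (4 , 3 , 4686) ∷ (4 , 3 , 4684) ∷ (2 , 1 , 6) ∷ (3 , 3 , 198) ∷ (3 , 3 , 196)
  ∷ (2 , 1 , 2) ∷ (3 , 3 , 68) ∷ (1 , 1 , 0) ∷ (2 , 3 , 0) ∷ []) refl

opaque
  -- Evaluation of the greedy search gives at most 5 chains here and at most 95 for the next day.
  -- The declarations are opaque so that later proofs do not unfold the search.
  slotting₂ : Slotting 2 5
  slotting₂ = Slotting-weaken (≤-check refl) (chain-slotting 1 (cover 1) (cover-covers 1))

  slotting₃ : Slotting 3 95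
  slotting₃ = Slotting-weaken (≤-check refl) (chain-slotting 2 (cover 2) (cover-covers 2))

  slotting₄ : Slotting 4 (4 * 10 ^ 184)
  slotting₄ = Slotting-weaken (≤-check refl) (Heights.slotting 2 (cover 2) (cover-covers 2))

F3≤ : FLe 3 66
-- `2 * 5 * (1 + 4) + 4 * 4 = 66`.
F3≤ = FLe-weaken (≤-check refl) (FLe-suc slotting₂ F2≤)

F4≤ : FLe 4 13439
-- `2 * 95 * (1 + 66) + 4 * 5 = 12750`, which is below 13439.
F4≤ = FLe-weaken (≤-check refl) (FLe-suc slotting₃ F3≤)

F5≤ : FLe 5 (108 * 10 ^ 187)
-- `8 * 10 ^ 184 * (1 + 13439) + 24` is below `1.0753 * 10 ^ 189`.
F5≤ = FLe-weaken (≤-check refl) (FLe-suc slotting₄ F4≤)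

-- Lower bounds from single hot games

FGe-weaken : ∀ {b M N} → M ≤ N → FGe b N → FGe b M
FGe-weaken le (X , B , f) = X , B , λ n lt → f n (≤-trans lt le)

born : ∀ b X → Born b X → BornBy b X
born b X p = X , Born⇒birthday b X p , λ _ → refl

Born-switch : ∀ b {k} (a : Fin k → Game) → (∀ i → Born b (a i)) → Born (suc b) (switch a b)
Born-switch b a p = p , λ _ → Born-neg[] b

-- After a move to n from {n | -n}, Left still needs n further blue vertices.
hot-size : ∀ n D → digraphGame D ≋ switch {1} (λ _ → pos n) n → suc n + suc n ≤ size D
hot-size n D (p , q) = ≤-trans
  (+-mono-≤ (blues-> n all (⊲-≼-trans (pos n) X _ (⊲-byLeft (pos n) X zero (≼-refl (pos n))) q))
            (reds-> n all (≼-right _ X p zero)))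
  (blues+reds all)
  where
  open Bounds D
  X = switch {1} (λ _ → pos n) n
  all : Pos
  all _ = true

FGe-hot : ∀ n → FGe (suc n) (suc n + suc n)
FGe-hot n = X , born (suc n) X (Born-switch n {1} (λ _ → pos n) (λ _ → Born-pos n)) ,
  λ { m lt (D , refl , e) → 1+n≰n (≤-trans (s≤s (hot-size n D (≈⇒≋ e))) lt) }
  where X = switch {1} (λ _ → pos n) n

-- An antichain of games born by day 3

Born-gameOf : ∀ b us bs → (∀ {c r} → (c , r) ∈ us → Born b r) → Born (suc b) (gameOf us bs)
Born-gameOf b us bs p = (λ i → p (lefts-∈ us bs (∈-lookup {xs = lefts us bs} i))) ,
                        (λ j → p (rights-∈ us bs (∈-lookup {xs = rights us bs} j)))
  where
  lefts-∈ : ∀ us bs {x} → x ∈ lefts us bs → (true , x) ∈ us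
  lefts-∈ ((true , r) ∷ us) (true ∷ bs) (here refl) = here refl
  lefts-∈ ((true , r) ∷ us) (true ∷ bs) (there m) = there (lefts-∈ us bs m)
  lefts-∈ ((true , r) ∷ us) (false ∷ bs) m = there (lefts-∈ us bs m)
  lefts-∈ ((false , r) ∷ us) (_ ∷ bs) m = there (lefts-∈ us bs m)
  rights-∈ : ∀ us bs {x} → x ∈ rights us bs → (false , x) ∈ us
  rights-∈ ((false , r) ∷ us) (false ∷ bs) (here refl) = here refl
  rights-∈ ((false , r) ∷ us) (false ∷ bs) (there m) = there (rights-∈ us bs m)
  rights-∈ ((false , r) ∷ us) (true ∷ bs) m = there (rights-∈ us bs m)
  rights-∈ ((true , r) ∷ us) (_ ∷ bs) m = there (rights-∈ us bs m)

Born-cover : ∀ b {r} → r ∈ cover b → Born b r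
Born-cover zero (here refl) = refl , refl
Born-cover (suc b) m with bs , _ , refl ← ∈-map⁻ (gameOf (reversedProbes (cover b))) m =
  Born-gameOf b _ bs (λ p → Born-cover b (∈-probes⁻ (cover b) p))

sameBits : List Bool → List Bool → Bool
sameBits [] [] = true
sameBits (true ∷ as) (true ∷ bs)   = sameBits as bs
sameBits (false ∷ as) (false ∷ bs) = sameBits as bs
sameBits _ _ = false

sameBits-sound : ∀ as bs → sameBits as bs ≡ true → as ≡ bs
sameBits-sound [] [] e = refl
sameBits-sound (true ∷ as) (true ∷ bs) e   = cong (true ∷_) (sameBits-sound as bs e)
sameBits-sound (false ∷ as) (false ∷ bs) e = cong (false ∷_) (sameBits-sound as bs e)

sameBits-refl : ∀ as → sameBits as as ≡ true
sameBits-refl [] = refl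
sameBits-refl (true ∷ as)  = sameBits-refl as
sameBits-refl (false ∷ as) = sameBits-refl as

fresh : List Bool → List (List Bool) → Bool
fresh x [] = true
fresh x (y ∷ ys) = not (sameBits x y) ∧ fresh x ys

distinct : List (List Bool) → Bool
distinct [] = true
distinct (x ∷ xs) = fresh x xs ∧ distinct xs

fresh-≢ : ∀ x ys → fresh x ys ≡ true → ∀ j → x ≢ lookup ys j
fresh-≢ x (y ∷ ys) e zero refl with () ← trans (sym (cong not (sameBits-refl x))) (proj₁ (∧-true e))
fresh-≢ x (y ∷ ys) e (suc j) q = fresh-≢ x ys (proj₂ (∧-true {not (sameBits x y)} e)) j q

distinct-lookup : ∀ xs → distinct xs ≡ true → ∀ i j → lookup xs i ≡ lookup xs j → i ≡ j
distinct-lookup (x ∷ xs) e zero    zero    q = refl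
distinct-lookup (x ∷ xs) e zero    (suc j) q = ⊥-elim (fresh-≢ x xs (proj₁ (∧-true e)) j q)
distinct-lookup (x ∷ xs) e (suc i) zero    q = ⊥-elim (fresh-≢ x xs (proj₁ (∧-true e)) i (sym q))
distinct-lookup (x ∷ xs) e (suc i) (suc j) q = cong suc (distinct-lookup xs (proj₂ (∧-true {fresh x xs} e)) i j q)

-- A bit that differs would raise the number of trues. Codes of equal rank are thus comparable only
-- if they coincide.
leqBits-trues : ∀ as bs → leqBits as bs ≡ true → trues as ≡ trues bs → as ≡ bs
leqBits-trues [] [] p e = refl
leqBits-trues (true ∷ as) (true ∷ bs) p e   = cong (true ∷_) (leqBits-trues as bs p (suc-injective e))
leqBits-trues (false ∷ as) (false ∷ bs) p e = cong (false ∷_) (leqBits-trues as bs p e)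
leqBits-trues (false ∷ as) (true ∷ bs) p e  = ⊥-elim (1+n≰n (≤-trans (≤-reflexive (sym e)) (trues-mono as bs p)))
  where
  trues-mono : ∀ as bs → leqBits as bs ≡ true → trues as ≤ trues bs
  trues-mono [] [] p = z≤n
  trues-mono (true ∷ as) (true ∷ bs) p   = s≤s (trues-mono as bs p)
  trues-mono (false ∷ as) (true ∷ bs) p  = m≤n⇒m≤1+n (trues-mono as bs p)
  trues-mono (false ∷ as) (false ∷ bs) p = trues-mono as bs p

holds-≼ : ∀ G H → G ≼ H → ∀ u → holds G u ≡ true → holds H u ≡ true
holds-≼ G H p (true , r) e  = ⊲⇒holds H r (⊲-≼-trans r G H (holds⇒⊲ G r e) p)
holds-≼ G H p (false , r) e = ≼⇒leb r H (≼-trans r G H (leb-true r G e) p)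

holds-mono : ∀ G H us → G ≼ H → leqBits (map (holds G) us) (map (holds H) us) ≡ true
holds-mono G H [] p = refl
holds-mono G H (u ∷ us) p with holds G u in e
... | false = holds-mono G H us p
... | true rewrite holds-≼ G H p u e = holds-mono G H us p

-- A Boolean test for the hypothesis `threat` of `Reversal`.
threatens : Game → Bool
threatens G = anyFin (leftSize G) λ i → not (leb (leftOption G i) (pos 1)) ∧
  not (anyFin (rightSize (leftOption G i)) λ j → leb (rightOption (leftOption G i) j) G)

threatens-sound : ∀ G → threatens G ≡ true →
  ∃ λ l → pos 1 ⊲ leftOption G l × (∀ r → G ⊲ rightOption (leftOption G l) r)
threatens-sound G e with l , p ← anyFin-true (leftSize G) _ e with q , r ← ∧-true p =
  l , leb-false _ (pos 1) (not-true q) , λ j → leb-false _ G (anyFin-false _ _ (not-true r) j)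

-- The number of trues is the rank in the lattice of games born by the next day,
-- and length rs is the middle rank.
middle : List Game → List Bool → Bool
middle rs e = (trues e ≡ᵇ length rs) ∧ (sameBits (codeOf rs G) e ∧ threatens G)
  where G = gameOf (reversedProbes rs) e

record Antichain (b k : ℕ) : Set where
  field
    games     : Fin k → Game
    births    : ∀ i → Born b (games i)
    antichain : ∀ i j → games i ≼ games j → i ≡ j
    threat    : ∀ i → ∃ λ l → pos 1 ⊲ leftOption (games i) l ×
                  (∀ r → games i ⊲ rightOption (leftOption (games i) l) r)

filter-sound : ∀ {A : Set} (p : A → Bool) xs {x} → x ∈ filterᵇ p xs → p x ≡ true
filter-sound p (y ∷ xs) m with p y in e
filter-sound p (y ∷ xs) (here refl) | true = e
filter-sound p (y ∷ xs) (there m)   | true = filter-sound p xs m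
... | false = filter-sound p xs m

-- `G ≼ H` makes every true answer for `G` true for `H`. Since `middle` has checked that each list
-- is the code of its own game, comparable games have comparable codes of equal rank, which are
-- equal.
middle-antichain : ∀ b → (let A = filterᵇ (middle (cover b)) (codes (cover b))) →
  distinct A ≡ true → Antichain (suc b) (length A)
middle-antichain b d = record
  { games = game
  ; births = λ i → Born-gameOf b us _ (λ p → Born-cover b (∈-probes⁻ rs p))
  ; antichain = λ i j p → distinct-lookup A d i j
      (leqBits-trues _ _ (subst₂ (λ x y → leqBits x y ≡ true) (code i) (code j) (holds-mono (game i) (game j) us p))
        (trans (rank i) (sym (rank j))))
  ; threat = λ i → threatens-sound (game i) (proj₂ (∧-true (proj₂ (∧-true {trues (lookup A i) ≡ᵇ length rs} (valid i)))))
  }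
  where
  rs = cover b
  us = reversedProbes rs
  A  = filterᵇ (middle rs) (codes rs)
  game : Fin (length A) → Game
  game i = gameOf us (lookup A i)
  valid : ∀ i → middle rs (lookup A i) ≡ true
  valid i = filter-sound (middle rs) (codes rs) (∈-lookup {xs = A} i)
  rank : ∀ i → trues (lookup A i) ≡ length rs
  rank i = ≡ᵇ⇒≡ _ _ (subst T (sym (proj₁ (∧-true (valid i)))) tt)
  code : ∀ i → codeOf rs (game i) ≡ lookup A i
  code i = sameBits-sound _ _ (proj₁ (∧-true (proj₂ (∧-true {trues (lookup A i) ≡ᵇ length rs} (valid i)))))

opaque
  antichain₃ : ∃ λ k → 64 ≤ k × Antichain 3 k
  -- Evaluation filters all codes of day 3. The threshold 64 is one more than the bound in
  -- `few-options`.
  antichain₃ = _ , ≤-check refl , middle-antichain 2 refl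

-- The lower bound for `F(4)`

module _ {k} (A : Antichain 3 k) where
  open Antichain A

  low : ∀ i → neg[ 3 ] ≼ games i
  low i = Born⇒≽ 3 (games i) (births i)

  lowʳ : ∀ i j → neg[ 3 ] ≼ rightOption (games i) j
  lowʳ i j = Born⇒≽ 3 _ (Born-suc 2 _ (Born-right 2 (games i) (births i) j))

  few-vertices : 64 ≤ k → ∀ n → n < 16 → ¬ RealisableOn n (switch games 3)
  few-vertices 64≤k n (s≤s n≤15) (D , refl , e) =
    1+n≰n (≤-trans 64≤k (Reversal.few-options D games antichain low lowʳ threat n≤15 (≈⇒≋ e)))

FGe₄ : FGe 4 16
FGe₄ with k , 64≤k , A ← antichain₃ =
  switch games 3 , born 4 _ (Born-switch 3 games births) , few-vertices A 64≤k
  where open Antichain A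

-- Counting digraphs

-- If every `X i` equalled some `Φ c`, choosing such a `c` would embed `Fin N` into the smaller
-- `Fin M`. Equality is decidable, so a missed `X i` is found by search.
missed : ∀ {M N} (Φ : Fin M → Game) (X : Fin N → Game) → M < N → (∀ i j → X i ≋ X j → i ≡ j) →
  ∃ λ i → ∀ c → ¬ (Φ c ≋ X i)
missed {M} {N} Φ X M<N inj with search (λ i → not (anyFin M (λ c → ≋? (Φ c) (X i))))
... | inj₁ (i , e) = i , λ c p → true≢false (trans (sym (anyFin-intro M _ c (≋?-complete (Φ c) (X i) p))) (not-true e))
... | inj₂ all = ⊥-elim (<⇒≱ M<N (injective⇒≤ {f = λ i → proj₁ (hit i)}
    (λ {i} {j} e → inj i j (≋-trans (≋-sym (proj₂ (hit i))) (subst (λ c → Φ c ≋ X j) (sym e) (proj₂ (hit j)))))))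
  where
  hit : ∀ i → ∃ λ c → Φ c ≋ X i
  hit i with c , e ← anyFin-true M _ (not-false (all i)) = c , ≋?-sound (Φ c) (X i) e

bool : Fin 2 → Bool
bool zero    = false
bool (suc _) = true

fin : Bool → Fin 2
fin false = zero
fin true  = suc zero

bool-fin : ∀ b → bool (fin b) ≡ b
bool-fin true  = refl
bool-fin false = refl

bool-injective : ∀ i j → bool i ≡ bool j → i ≡ j
bool-injective zero zero e = refl
bool-injective (suc zero) (suc zero) e = refl

-- The value false outside the domain is junk.
extend : ∀ {n} → (Fin n → Bool) → ℕ → Bool
extend {n} f i with i <? n
... | yes p = f (fromℕ< p)
... | no _  = false

extend-toℕ : ∀ {n} (f : Fin n → Bool) i → extend f (toℕ i) ≡ f i
extend-toℕ {n} f i with toℕ i <? n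
... | yes p = cong f (fromℕ<-toℕ i p)
... | no ¬p = ⊥-elim (¬p (toℕ<n i))

extend₂ : ∀ {n} → (Fin n → Fin n → Bool) → ℕ → ℕ → Bool
extend₂ {n} f i = extend (λ j → extend (λ k → f k j) i)

extend₂-toℕ : ∀ {n} (f : Fin n → Fin n → Bool) i j → extend₂ f (toℕ i) (toℕ j) ≡ f i j
extend₂-toℕ f i j = trans (extend-toℕ _ j) (extend-toℕ (λ k → f k j) i)

restricted : ℕ → (ℕ → Bool) → (ℕ → ℕ → Bool) → Digraph
restricted n c a = record { size = n ; blue = c ∘ toℕ ; arc = λ u v → a (toℕ u) (toℕ v) }

digraph-≼ : ∀ n {c c' : Fin n → Bool} {a a' : Fin n → Fin n → Bool} → (∀ v → c v ≡ c' v) → (∀ u v → a u v ≡ a' u v) →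
  digraphGame (record { size = n ; blue = c ; arc = a }) ≼ digraphGame (record { size = n ; blue = c' ; arc = a' })
digraph-≼ n {c} {c'} {a} {a'} p q = simulation E E' (λ S S' → ∀ v → S v ≡ S' v)
  (λ S S' r v s b → v , trans (sym (r v)) s , trans (sym (p v)) b , step S S' r v)
  (λ S S' r v s b → v , trans (r v) s , trans (p v) b , step S S' r v)
  _ _ _ _ (count-≤ (λ _ → true)) (count-≤ (λ _ → true)) (λ _ → refl)
  where
  E  = record { size = n ; blue = c ; arc = a }
  E' = record { size = n ; blue = c' ; arc = a' }
  step : ∀ S S' → (∀ v → S v ≡ S' v) → ∀ v w → delete E v S w ≡ delete E' v S' w
  step S S' r v w rewrite r w | q v w = refl

module Encoding (n : ℕ) where

  -- A digraph on fewer than `n` vertices is coded by its size and by its colours and arcs, padded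
  -- to `n` vertices.
  digraphCodes : ℕ
  digraphCodes = n * (2 ^ n * 2 ^ (n * n))

  arcsOf : (Fin (n * n) → Fin 2) → Fin n → Fin n → Bool
  arcsOf g u v = bool (g (combine u v))

  digraphOf : Fin n → (Fin n → Fin 2) → (Fin (n * n) → Fin 2) → Digraph
  digraphOf k f g = restricted (toℕ k) (extend (bool ∘ f)) (extend₂ (arcsOf g))

  unpack₂ : Fin n → Fin (2 ^ n) × Fin (2 ^ (n * n)) → Digraph
  unpack₂ k (x , y) = digraphOf k (finToFun x) (finToFun y)

  unpack : Fin n × Fin (2 ^ n * 2 ^ (n * n)) → Digraph
  unpack (k , d) = unpack₂ k (remQuot (2 ^ (n * n)) d)

  decoded : Fin digraphCodes → Digraph
  decoded c = unpack (remQuot (2 ^ n * 2 ^ (n * n)) c)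

  encoded : ∀ D → size D < n → ∃ λ c → digraphGame (decoded c) ≋ digraphGame D
  encoded D lt = c , subst (λ E → digraphGame E ≋ digraphGame D) (sym decoded-c) good
    where
    f : Fin n → Fin 2
    f v = fin (extend (blue D) (toℕ v))
    g : Fin (n * n) → Fin 2
    g w = fin (extend₂ (arc D) (toℕ (quotient {n} n w)) (toℕ (remainder {n} n w)))
    k = fromℕ< lt
    c₂ = combine (funToFin f) (funToFin g)
    c  = combine k c₂
    f′ = finToFun (funToFin f)
    g′ = finToFun (funToFin g)
    decoded-c : decoded c ≡ digraphOf k f′ g′
    decoded-c = trans (cong unpack (remQuot-combine k c₂)) (cong (unpack₂ k) (remQuot-combine (funToFin f) (funToFin g)))
    colour : ∀ u → extend (bool ∘ f′) (toℕ u) ≡ extend (blue D) (toℕ u)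
    colour u = trans (extend-toℕ (bool ∘ f′) u) (trans (cong bool (finToFun-funToFin f u)) (bool-fin _))
    arcs : ∀ u v → extend₂ (arcsOf g′) (toℕ u) (toℕ v) ≡ extend₂ (arc D) (toℕ u) (toℕ v)
    arcs u v = trans (extend₂-toℕ (arcsOf g′) u v)
      (trans (cong bool (finToFun-funToFin g (combine u v))) (trans (bool-fin _)
        (cong₂ (λ x y → extend₂ (arc D) (toℕ x) (toℕ y)) (cong proj₁ (remQuot-combine u v)) (cong proj₂ (remQuot-combine u v)))))
    widen : ∀ (v : Fin (size D)) → ∃ λ (u : Fin n) → toℕ u ≡ toℕ v
    widen v = inject≤ v (<⇒≤ lt) , toℕ-inject≤ v (<⇒≤ lt)
    colour′ : ∀ v → extend (bool ∘ f′) (toℕ v) ≡ blue D v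
    colour′ v with u , e ← widen v =
      trans (subst (λ i → extend (bool ∘ f′) i ≡ extend (blue D) i) e (colour u)) (extend-toℕ (blue D) v)
    arcs′ : ∀ v w → extend₂ (arcsOf g′) (toℕ v) (toℕ w) ≡ arc D v w
    arcs′ v w with u , e ← widen v | u′ , e′ ← widen w =
      trans (subst₂ (λ i j → extend₂ (arcsOf g′) i j ≡ extend₂ (arc D) i j) e e′ (arcs u u′))
            (extend₂-toℕ (arc D) v w)
    good : digraphGame (digraphOf k f′ g′) ≋ digraphGame D
    good rewrite toℕ-fromℕ< lt = digraph-≼ (size D) colour′ arcs′ ,
      digraph-≼ (size D) (λ v → sym (colour′ v)) (λ v w → sym (arcs′ v w))

-- With `n = 2 ^ m` the number of codes is a power of two, so only exponents need to be compared and
-- the huge powers are never evaluated.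
digraphCodes-< : ∀ m K → m + (2 ^ m + 2 ^ m * 2 ^ m) < K → Encoding.digraphCodes (2 ^ m) < 2 ^ K
digraphCodes-< m K lt = subst (_< 2 ^ K)
  (trans (^-distribˡ-+-* 2 m (n + n * n)) (cong (2 ^ m *_) (^-distribˡ-+-* 2 n (n * n))))
  (^-monoʳ-< 2 (s≤s (s≤s z≤n)) lt)
  where n = 2 ^ m

unrealisable : ∀ m K (X : Fin (2 ^ K) → Game) → m + (2 ^ m + 2 ^ m * 2 ^ m) < K → (∀ i j → X i ≋ X j → i ≡ j) →
  ∃ λ i → ∀ n → n < 2 ^ m → ¬ RealisableOn n (X i)
unrealisable m K X lt inj with i , miss ← missed (λ c → digraphGame (Encoding.decoded (2 ^ m) c)) X (digraphCodes-< m K lt) inj =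
  i , λ { n n< (D , refl , e) → let c , p = Encoding.encoded (2 ^ m) D n< in miss c (≋-trans p (≈⇒≋ e)) }

finToFun-injective : ∀ {m n} (u v : Fin (m ^ n)) → (∀ i → finToFun {m} {n} u i ≡ finToFun {m} {n} v i) → u ≡ v
finToFun-injective {m} {n} u v e =
  trans (sym (funToFin-finToFin {n} {m} u)) (trans (funToFin-cong e) (funToFin-finToFin {n} {m} v))
  where
  funToFin-cong : ∀ {n m} {f g : Fin n → Fin m} → (∀ i → f i ≡ g i) → funToFin f ≡ funToFin g
  funToFin-cong {zero}  e = refl
  funToFin-cong {suc n} e = cong₂ combine (e zero) (funToFin-cong (e ∘ suc))

-- Hot games over an antichain

module Transversals {k} (A : Antichain 3 k) (j : ℕ) (wide : suc j * 2 ≤ k) where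
  open Antichain A

  digits : Fin (2 ^ suc j) → Fin (suc j) → Fin 2
  digits = finToFun

  subset : Fin (2 ^ (2 ^ suc j)) → Fin (2 ^ suc j) → Fin 2
  subset = finToFun

  pick : Fin (suc j) → Fin 2 → Fin k
  pick i x = inject≤ (combine i x) wide

  -- The antichain supplies `suc j` disjoint pairs, and the binary digits of `u` choose one game
  -- from each as a Left option.
  transversal : Fin (2 ^ suc j) → Game
  transversal u = switch (λ i → games (pick i (digits u i))) 3

  -- Each Left option for `u` must lie below one for `v`, as `lowʳ` excludes the alternative. By the
  -- antichain condition the two are the same game, so they come from the same pair with the same
  -- digit.
  transversal-antichain : ∀ u v → transversal u ≼ transversal v → u ≡ v
  transversal-antichain u v p = finToFun-injective u v same
    where
    same : ∀ i → digits u i ≡ digits v i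
    same i with ⊲-elim _ (transversal v) (≼-left (transversal u) _ p i)
    ... | inj₁ (r , q) = ⊥-elim (≼⇒¬⊲ _ _ (lowʳ A (pick i (digits u i)) r) (≼-right _ (transversal v) q zero))
    ... | inj₂ (i′ , q) with combine-injective i _ i′ _ (inject≤-injective wide wide _ _ (antichain _ _ q))
    ...   | refl , e = e

  Born-transversal : ∀ u → Born 4 (transversal u)
  Born-transversal u = Born-switch 3 (λ i → games (pick i (digits u i))) (λ i → births _)

  -- The filler `-4` for an unselected index is not above any transversal, so it lets all subsets
  -- share one index set.
  chosen : (Fin (2 ^ suc j) → Bool) → Fin (2 ^ suc j) → Game
  chosen S u = if S u then transversal u else neg[ 4 ]

  family : Fin (2 ^ (2 ^ suc j)) → Game
  family w = switch (chosen (bool ∘ subset w)) 4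

  Born-family : ∀ w → Born 5 (family w)
  Born-family w = Born-switch 4 (chosen S) births′
    where
    S = bool ∘ subset w
    births′ : ∀ u → Born 4 (chosen S u)
    births′ u with S u
    ... | true  = Born-transversal u
    ... | false = Born-neg[] 4

  neg-≼ : neg[ 4 ] ≼ neg[ 3 ]
  neg-≼ = Born⇒≽ 4 neg[ 3 ] (Born-suc 3 neg[ 3 ] (Born-neg[] 3))

  private
    -- A selected transversal `u` must lie below a Left option on the other side. This option is not
    -- the filler `-4`, so it is a selected transversal and equals the given one. Its Right option
    -- `-3` cannot serve instead, since `-3` is not below a game from which Right can move to `-4`.
    included : ∀ S T u → switch (chosen S) 4 ≼ switch (chosen T) 4 → S u ≡ true → T u ≡ true
    included S T u p e with ⊲-elim (transversal u) (switch (chosen T) 4)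
      (subst (λ b → (if b then transversal u else neg[ 4 ]) ⊲ switch (chosen T) 4) e (≼-left _ (switch (chosen T) 4) p u))
    ... | inj₁ (zero , q) = ⊥-elim (≼⇒¬⊲ _ _ neg-≼ (≼-right neg[ 3 ] (switch (chosen T) 4) q zero))
    ... | inj₂ (v , q) with T v in e′
    ...   | true with refl ← transversal-antichain u v q = e′
    ...   | false = ⊥-elim (≼⇒¬⊲ _ _ (≼-trans neg[ 4 ] _ _ neg-≼ (low A (pick zero (digits u zero)))) (≼-left (transversal u) neg[ 4 ] q zero))

  family-injective : ∀ w w′ → family w ≋ family w′ → w ≡ w′
  family-injective w w′ (p , q) =
    finToFun-injective w w′ (λ u → bool-injective _ _ (same u))
    where
    iff : ∀ {a b} → (a ≡ true → b ≡ true) → (b ≡ true → a ≡ true) → a ≡ b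
    iff {true} f g = sym (f refl)
    iff {false} {true} f g = g refl
    iff {false} {false} f g = refl
    same : ∀ u → bool (subset w u) ≡ bool (subset w′ u)
    same u = iff (included (bool ∘ subset w) (bool ∘ subset w′) u p) (included (bool ∘ subset w′) (bool ∘ subset w) u q)

many-vertices : ∀ m j {k} (A : Antichain 3 k) → suc j * 2 ≤ k → m + (2 ^ m + 2 ^ m * 2 ^ m) < 2 ^ suc j → FGe 5 (2 ^ m)
many-vertices m j A wide lt with w , p ← unrealisable m (2 ^ suc j) (Transversals.family A j wide) lt (Transversals.family-injective A j wide) =
  Transversals.family A j wide w , born 5 _ (Transversals.Born-family A j wide w) , p

FGe₅ : FGe 5 256
-- Seventeen pairs use 34 games of the antichain and give `2 ^ 17` transversals. There are at most
-- `2 ^ 65800` digraph codes, and `8 + 2 ^ 8 + 2 ^ 16 = 65800` is less than `2 ^ 17`.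
FGe₅ with k , 64≤k , A ← antichain₃ = many-vertices 8 16 A (≤-trans (≤-check refl) 64≤k) (≤-check refl)

theorem13 : FEq 0 0 × FEq 1 2 × FEq 2 4
    × (FGe 3 5 × FLe 3 74)
    × (FGe 4 16 × FLe 4 13439)
    × (FGe 5 256 × FLe 5 (108 * 10 ^ 187))
theorem13 =
  (F0≤ , 0ᵍ , born 0 0ᵍ (refl , refl) , λ _ ()) ,
  (F1≤ , FGe-hot 0) ,
  (F2≤ , FGe-hot 1) ,
  (FGe-weaken (≤-check refl) (FGe-hot 2) , FLe-weaken (≤-check refl) F3≤) ,
  (FGe₄ , F4≤) ,
  (FGe₅ , F5≤)
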